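{- Let $m\ge 1$ and let $\nu_1,\ldots,\nu_m,l_1,\ldots,l_m$ be positive integers with $1\le \nu_j\le l_j$ for $j=1,\ldots,m$; put $M:=\nu_1+\ldots+\nu_m$ and $L:=l_1+\ldots+l_m$ (so $M\le L$). Let $\alpha_1,\ldots,\alpha_m$ be distinct variables and $\overline{\alpha}=(\alpha_1,\ldots,\alpha_m)^T$. Let $\mathcal{V}(\overline{\alpha})$ be the $M\times(L+1)$ matrix over $\mathbb{Z}[\alpha_1,\ldots,\alpha_m]$ whose rows are indexed by the pairs $(j,i)$ with $j=1,\ldots,m$ and $i=1,\ldots,\nu_j$ (ordered lexicographically), whose columns are indexed by $h=0,1,\ldots,L$, and whose entry in row $(j,i)$ and column $h$ is $\binom{L+i}{h}\alpha_j^{L-h}$. Let $\widehat{D}(\overline{\alpha})\in\mathbb{Z}[\alpha_1,\ldots,\alpha_m]$ be the (primitive) greatest common divisor of the $M\times M$ minors of $\mathcal{V}(\overline{\alpha})$. Then, in $\mathbb{Z}[\alpha_1,\ldots,\alpha_m]$, $$ \left(\prod_{1\le j\le m}\alpha_j^{\binom{\nu_j}{2}}\right)\prod_{1\le i<j\le m}(\alpha_i-\alpha_j)^{\min\{\nu_i^2,\,\nu_j^2\}}\ \Big|\ \widehat{D}(\overline{\alpha}). $$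
   Context: A polynomial in $\mathbb{Z}[\alpha_1,\ldots,\alpha_m]$ is primitive if the gcd of its coefficients is $1$. The polynomial $\widehat{D}(\overline{\alpha})$ is taken to be primitive: it is the greatest common divisor of the minors in the UFD $\mathbb{Z}[\alpha_1,\ldots,\alpha_m]$ with its integer content divided out. -}

module Defs where

open import Algebra.Bundles.Raw using (RawMagma; RawRing)
import Algebra.Definitions.RawMagma as MagmaDefs
import Algebra.Definitions.RawSemiring as SemiringDefs
open import Data.Bool.Base using (if_then_else_)
open import Data.Fin.Base as Fin using (Fin; zero; suc; toℕ; splitAt)
import Data.Fin.Properties as Fin
open import Data.Integer.Base as ℤ using (ℤ; +_; 0ℤ; 1ℤ)
open import Data.List.Base as List using (List; []; _∷_)
open import Data.Nat.Base as ℕ using (ℕ; suc; _∸_; _⊓_)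
open import Data.Nat.Combinatorics using (_C_)
import Data.Nat.Properties as ℕ
open import Data.Product.Base using (Σ-syntax; _×_; _,_)
open import Data.Sum.Base using ([_,_]′)
open import Data.Vec.Base as Vec using (Vec; _[_]≔_)
open import Data.Vec.Functional as Vector using (Vector; removeAt)
open import Data.Vec.Properties using (≡-dec)
open import Level using (0ℓ; _⊔_)
open import Relation.Binary.Core using (_Preserves_⟶_)
open import Relation.Binary.PropositionalEquality.Core using (_≡_)
open import Relation.Nullary.Decidable.Core using (does)

-- Greatest common divisor of an arbitrary family of elements.  It is
-- determined only up to associates, hence a predicate.

record IsGCD {a ℓ i} (M : RawMagma a ℓ) {I : Set i}
             (f : I → RawMagma.Carrier M) (g : RawMagma.Carrier M)
             : Set (a ⊔ ℓ ⊔ i) where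
  open MagmaDefs M using (_∣_)
  field
    divides  : ∀ i → g ∣ f i
    greatest : ∀ d → (∀ i → d ∣ f i) → d ∣ g

module Matrices {c ℓ} (R : RawRing c ℓ) where

  open RawRing R
  open SemiringDefs rawSemiring using (sum; _^_)

  Matrix : ℕ → ℕ → Set c
  Matrix m n = Vector (Vector Carrier n) m

  -- Laplace expansion along the first row.
  det : ∀ {n} → Matrix n n → Carrier
  det {0}     A = 1#
  det {suc n} A = sum λ j →
    (- 1#) ^ toℕ j * A zero j * det (λ i → removeAt (A (suc i)) j)

  -- The choices of m among n columns, as increasing maps.
  Columns : ℕ → ℕ → Set
  Columns m n = Σ[ c ∈ (Fin m → Fin n) ] c Preserves Fin._<_ ⟶ Fin._<_

  maximalMinor : ∀ {m n} → Matrix m n → Columns m n → Carrier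
  maximalMinor A (c , _) = det λ i k → A i (c k)

-- ℤ[α₁,…,αₘ]: a polynomial is a list of terms (coefficient, exponent
-- vector) in which the same exponent vector may occur repeatedly and
-- coefficients may be 0; two polynomials are equal when all their
-- collected coefficients agree.

ℤ[α] : ℕ → Set
ℤ[α] m = List (ℤ × Vec ℕ m)

module _ {m : ℕ} where

  infix  4 _≈_
  infixl 6 _+_
  infixl 7 _*_
  infix  8 -_

  coeff : ℤ[α] m → Vec ℕ m → ℤ
  coeff []            e = 0ℤ
  coeff ((a , d) ∷ p) e =
    (if does (≡-dec ℕ._≟_ d e) then a else 0ℤ) ℤ.+ coeff p e

  record _≈_ (p q : ℤ[α] m) : Set where
    constructor mk≈
    field
      coeff-≡ : ∀ e → coeff p e ≡ coeff q e

  const : ℤ → ℤ[α] m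
  const a = (a , Vec.replicate m 0) ∷ []

  var : Fin m → ℤ[α] m
  var j = (1ℤ , (Vec.replicate m 0 [ j ]≔ 1)) ∷ []

  _+_ : ℤ[α] m → ℤ[α] m → ℤ[α] m
  _+_ = List._++_

  _*_ : ℤ[α] m → ℤ[α] m → ℤ[α] m
  _*_ = List.cartesianProductWith
    λ (a , d) (b , e) → a ℤ.* b , Vec.zipWith ℕ._+_ d e

  -_ : ℤ[α] m → ℤ[α] m
  -_ = List.map λ (a , d) → ℤ.- a , d

ℤ[α]-rawRing : ℕ → RawRing 0ℓ 0ℓ
ℤ[α]-rawRing m = record
  { Carrier = ℤ[α] m
  ; _≈_     = _≈_
  ; _+_     = _+_
  ; _*_     = _*_
  ; -_      = -_
  ; 0#      = []
  ; 1#      = const 1ℤ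
  }

module _ {m : ℕ} where

  open RawRing (ℤ[α]-rawRing m) using (rawSemiring; *-rawMagma)
  open SemiringDefs rawSemiring public using (_∣_; _^_; product)
  open Matrices (ℤ[α]-rawRing m) public

  IsContent : ℤ[α] m → ℤ → Set
  IsContent p c = IsGCD ℤ.*-rawMagma (coeff p) c

  Primitive : ℤ[α] m → Set
  Primitive p = IsContent p 1ℤ

  -- D is a greatest common divisor of the family f in ℤ[α] with its
  -- integer content divided out.  Dividing by the content requires it to
  -- be nonzero, i.e. the family f not to be identically zero.
  record IsPrimitiveGCD {I : Set} (f : I → ℤ[α] m) (D : ℤ[α] m) : Set where
    field
      gcd               : ℤ[α] m
      gcd-isGCD         : IsGCD *-rawMagma f gcd
      content           : ℤ
      content-isContent : IsContent gcd content
      content-nonZero   : ℤ.NonZero content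
      gcd≈content*D     : gcd ≈ const content * D
      D-primitive       : Primitive D

∑ : ∀ {m} → Vector ℕ m → ℕ
∑ = Vector.foldr ℕ._+_ 0

-- The k-th pair (j , i) with j < m and i < ν j in lexicographic order.
rowIndex : ∀ {m} (ν : Vector ℕ m) → Fin (∑ ν) → Σ[ j ∈ Fin m ] Fin (ν j)
rowIndex {suc m} ν k =
  [ (λ i → zero , i)
  , (λ k′ → let (j , i) = rowIndex (Vector.tail ν) k′ in suc j , i)
  ]′ (splitAt (ν zero) k)

-- The index i counts from 0 here, so binom(L + i, h) becomes
-- binom(L + suc i, h).
𝒱 : ∀ {m} (ν l : Vector ℕ m) → Matrix {m} (∑ ν) (suc (∑ l))
𝒱 ν l k h =
  let (j , i) = rowIndex ν k
      L       = ∑ l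
  in  const (+ ((L ℕ.+ suc (toℕ i)) C toℕ h)) * var j ^ (L ∸ toℕ h)

-- (∏_j α_j ^ binom(ν_j, 2)) · ∏_{i<j} (α_i − α_j) ^ min(ν_i², ν_j²)
divisor : ∀ {m} → Vector ℕ m → ℤ[α] m
divisor ν =
  product (λ j → var j ^ (ν j C 2)) *
  product (λ i → product λ j →
    if does (i Fin.<? j)
    then (var i + - var j) ^ ((ν i ℕ.^ 2) ⊓ (ν j ℕ.^ 2))
    else const 1ℤ)

{-# OPTIONS --safe #-}

-- Let f_i(x) be the vector with entries binom(L + i, h) x^(L − h), so that the
-- rows of the matrix are f_i(α_j).  With D_k the k-th divided derivative,
--   (L + i) D_k f_{i−1} = (i + k) D_k f_i + (k + 1) x D_{k+1} f_i,
-- so up to nonzero integers the rows f_1(x), …, f_n(x) may be exchanged one at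
-- a time for D_{n−1} f_n, …, D_0 f_n, which extracts x^binom(n, 2) from every
-- minor.  For x = α_i, y = α_j and n = min(ν_i, ν_j), the recurrence
--   f[x^(a+1), y^b] = (x − y) f[x^(a+1), y^(b+1)] + f[x^a, y^(b+1)]
-- for the divided differences of f_n exchanges f[x^a] for f[x^a, y^n] for all
-- a ≤ n, in n² steps that extract one factor x − y each.
-- The factors α_j, α_i − α_j and the nonzero integers are regular modulo each
-- other: α_i − q generates the kernel of the substitution α_i ↦ q, which takes
-- the other factors to non-zero-divisors.  Hence the prime powers combine, and
-- integer factors can be cancelled, both in the minors and in content · D̂.
module Submission where

open import Defs using (module Matrices)
open import Algebra.Bundles using (CommutativeRing; Semiring)
import Algebra.Definitions.RawMagma as MagmaDefs
import Algebra.Definitions.RawSemiring as SemiringDefs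
import Algebra.Properties.AbelianGroup as AbelianGroupProperties
import Algebra.Properties.Magma.Divisibility as MagmaDivisibility
import Algebra.Properties.Ring as RingProperties
import Algebra.Properties.Semiring.Exp as SemiringExp
import Algebra.Properties.Semiring.Mult as SemiringMult
import Algebra.Properties.Semiring.Sum as SemiringSum
import Algebra.Solver.Ring.NaturalCoefficients.Default as SemiringSolver
open import Data.Bool.Base using (true; false; if_then_else_)
open import Data.Empty using (⊥-elim)
open import Data.Fin.Base as Fin using (Fin; zero; suc; toℕ; inject₁; punchIn; splitAt; _↑ˡ_; _↑ʳ_)
import Data.Fin.Properties as Fin
import Data.Integer.Properties as ℤ
import Data.Integer.Solver as ℤ-Solver
open import Data.List.Base as List using ([]; _∷_; length)
open import Data.Maybe.Base using (Maybe; just; nothing)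
open import Data.Maybe.Properties using (just-injective)
open import Data.Nat.Base as ℕ using (ℕ; zero; suc; pred; _≤_; _<_; z≤n; s≤s; _∸_; _⊓_)
open import Data.Nat.Combinatorics using (_C_; nCk+nC[k+1]≡[n+1]C[k+1]; nC1≡n)
import Data.Nat.Properties as ℕ
import Data.Nat.Solver as ℕ-Solver
open import Data.Product.Base using (Σ-syntax; _×_; _,_; proj₁; proj₂; ∃-syntax)
open import Data.Product.Properties using (≡-dec; ,-injectiveˡ; ,-injectiveʳ)
open import Data.Sum.Base using (inj₁; inj₂)
open import Data.Vec.Base as Vec using (Vec; []; _∷_; lookup; _[_]≔_)
open import Data.Vec.Functional using (Vector; removeAt; tail)
import Data.Vec.Properties as Vec
open import Function.Base using (_∘_)
open import Function.Definitions using (Injective)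
open import Level using (0ℓ; _⊔_)
open import Relation.Binary.Definitions using (DecidableEquality; tri<; tri≈; tri>)
open import Relation.Binary.PropositionalEquality.Core as ≡ using (_≡_; _≢_)
open import Relation.Binary.PropositionalEquality.Properties using (module ≡-Reasoning)
open import Relation.Nullary.Decidable using (dec-true; dec-false)
open import Relation.Nullary.Decidable.Core using (Dec; does; yes; no)

-- Determinants

-- The function f_i is the same in every block; only the point α_j differs. Once all rows of a block
-- are divided derivatives of its last function, they are divided differences of one function with
-- repeated nodes. Restricting two blocks to their first n = min(ν_i, ν_j) rows makes that function
-- common to both, and this is what allows nodes of one block to be added to rows of the other. The
-- exponent n² counts nodes: each of n rows gains n of them.
--
-- The reduction for one pair of blocks destroys the rows from which another pair would have to
-- start. Each prime power is therefore extracted separately from the original minor, everything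
-- else that comes out on the way is absorbed into a cofactor, and coprimality joins the powers
-- afterwards. Coprimality is taken as cancellation modulo an element, because a substitution can
-- test it.

module _ {a b} {K : Set a} {V : Set b} (_≟_ : DecidableEquality K) where

  -- The keys are arbitrary because rows are indexed by `Fin n` inside a determinant, but by pairs
  -- (block, position) in the reductions.
  replaceAt : (K → V) → K → V → (K → V)
  replaceAt A i v k = if does (k ≟ i) then v else A k

  replaceAt-updates : ∀ A i v → replaceAt A i v i ≡ v
  replaceAt-updates A i v with i ≟ i
  ... | yes _   = ≡.refl
  ... | no  i≢i = ⊥-elim (i≢i ≡.refl)

  replaceAt-minimal : ∀ A {i k} v → k ≢ i → replaceAt A i v k ≡ A k
  replaceAt-minimal A {i} {k} v k≢i with k ≟ i
  ... | yes k≡i = ⊥-elim (k≢i k≡i)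
  ... | no  _   = ≡.refl

-- For j ≤ k, deleting `inject₁ j` and then `k`, or `suc k` and then `j`, removes the same two
-- columns j < k + 1. This and the next two equations match the terms of the two orders in a double
-- Laplace expansion.
punchIn-inject₁ : ∀ {n} {j k : Fin (suc n)} → toℕ j ≤ toℕ k →
                  punchIn (inject₁ j) k ≡ suc k
punchIn-inject₁ {j = zero}              _         = ≡.refl
punchIn-inject₁ {suc n} {suc j} {suc k} (s≤s j≤k) = ≡.cong suc (punchIn-inject₁ j≤k)

punchIn-suc : ∀ {n} {j k : Fin (suc n)} → toℕ j ≤ toℕ k →
              punchIn (suc k) j ≡ inject₁ j
punchIn-suc {j = zero}              _         = ≡.refl
punchIn-suc {suc n} {suc j} {suc k} (s≤s j≤k) = ≡.cong suc (punchIn-suc j≤k)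

punchIn-punchIn : ∀ {n} {j k : Fin (suc n)} → toℕ j ≤ toℕ k → ∀ c →
                  punchIn (inject₁ j) (punchIn k c) ≡ punchIn (suc k) (punchIn j c)
punchIn-punchIn {j = zero}              _         c       = ≡.refl
punchIn-punchIn {suc n} {suc j} {suc k} (s≤s j≤k) zero    = ≡.refl
punchIn-punchIn {suc n} {suc j} {suc k} (s≤s j≤k) (suc c) =
  ≡.cong suc (punchIn-punchIn j≤k c)

module Determinant {c ℓ} (R : CommutativeRing c ℓ) where

  open CommutativeRing R hiding (zero)
  open Matrices rawRing
  open SemiringSum semiring using (sum; sum-cong-≋; ∑-distrib-+; *-distribˡ-sum)
  open SemiringSolver commutativeSemiring using (solve; _:=_; _:+_; _:*_; con)
  open SemiringDefs (Semiring.rawSemiring semiring) using (_^_)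
  open import Relation.Binary.Reasoning.Setoid setoid

  infix 4 _≋_
  _≋_ : ∀ {n} → Vector Carrier n → Vector Carrier n → Set ℓ
  u ≋ v = ∀ j → u j ≈ v j

  sum-linear : ∀ {n} {s t} {f g h : Vector Carrier n} →
               (∀ j → f j ≈ s * g j + t * h j) → sum f ≈ s * sum g + t * sum h
  sum-linear {s = s} {t} {f} {g} {h} eq = begin
    sum f                                             ≈⟨ sum-cong-≋ eq ⟩
    sum (λ j → s * g j + t * h j)                     ≈⟨ ∑-distrib-+ (λ j → s * g j) (λ j → t * h j) ⟩
    sum (λ j → s * g j) + sum (λ j → t * h j)
      ≈⟨ +-cong (*-distribˡ-sum s g) (*-distribˡ-sum t h) ⟨
    s * sum g + t * sum h                             ∎

  sum-zero : ∀ {n} {f : Vector Carrier n} → (∀ j → f j ≈ 0#) → sum f ≈ 0#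
  sum-zero {zero}  f≈0 = refl
  sum-zero {suc n} f≈0 = trans (+-cong (f≈0 zero) (sum-zero (f≈0 ∘ suc))) (+-identityˡ 0#)

  -- The index pairs fall into couples (j, k) and (k + 1, j) with j ≤ k. Row 0 is coupled with
  -- column 0 of the later rows; without them the same pattern remains, one size smaller.
  sum-sum-cancel : ∀ {n} (G : Fin (suc n) → Fin n → Carrier) →
                   (∀ j k → toℕ j ≤ toℕ k → G (inject₁ j) k + G (suc k) j ≈ 0#) →
                   sum (λ j → sum (G j)) ≈ 0#
  sum-sum-cancel {zero}  G cancel = +-identityˡ 0#
  sum-sum-cancel {suc n} G cancel = begin
    sum (G zero) + sum (λ j → G (suc j) zero + sum (λ k → G (suc j) (suc k)))
      ≈⟨ +-congˡ (∑-distrib-+ (λ j → G (suc j) zero) (λ j → sum (λ k → G (suc j) (suc k)))) ⟩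
    sum (G zero) + (sum (λ j → G (suc j) zero) + sum (λ j → sum (λ k → G (suc j) (suc k))))
      ≈⟨ +-assoc _ _ _ ⟨
    (sum (G zero) + sum (λ j → G (suc j) zero)) + sum (λ j → sum (λ k → G (suc j) (suc k)))
      ≈⟨ +-cong (sym (∑-distrib-+ (G zero) (λ j → G (suc j) zero)))
                (sum-sum-cancel (λ j k → G (suc j) (suc k))
                  (λ j k j≤k → cancel (suc j) (suc k) (s≤s j≤k))) ⟩
    sum (λ j → G zero j + G (suc j) zero) + 0#
      ≈⟨ +-identityʳ _ ⟩
    sum (λ j → G zero j + G (suc j) zero)
      ≈⟨ sum-zero (λ k → cancel zero k z≤n) ⟩
    0# ∎

  det-cong : ∀ {n} (A B : Matrix n n) → (∀ k → A k ≋ B k) → det A ≈ det B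
  det-cong {zero}  A B A≋B = refl
  det-cong {suc n} A B A≋B = sum-cong-≋ λ j →
    *-cong (*-congˡ {x = (- 1#) ^ toℕ j} (A≋B zero j)) (det-cong _ _ λ k → A≋B (suc k) ∘ punchIn j)

  det-linear : ∀ {n} (A B C : Matrix n n) {s t} i →
               (∀ k → k ≢ i → A k ≋ B k) → (∀ k → k ≢ i → A k ≋ C k) →
               (∀ j → A i j ≈ s * B i j + t * C i j) →
               det A ≈ s * det B + t * det C
  det-linear {suc n} A B C {s} {t} zero A≋B A≋C Aᵢ = sum-linear λ j → begin
    (- 1#) ^ toℕ j * A zero j * det (λ k → removeAt (A (suc k)) j)
      ≈⟨ *-congʳ (*-congˡ (Aᵢ j)) ⟩
    (- 1#) ^ toℕ j * (s * B zero j + t * C zero j) * det (λ k → removeAt (A (suc k)) j)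
      ≈⟨ solve 6 (λ σ s b t c d → σ :* (s :* b :+ t :* c) :* d :=
                    s :* (σ :* b :* d) :+ t :* (σ :* c :* d)) refl _ _ _ _ _ _ ⟩
    s * ((- 1#) ^ toℕ j * B zero j * det (λ k → removeAt (A (suc k)) j)) +
    t * ((- 1#) ^ toℕ j * C zero j * det (λ k → removeAt (A (suc k)) j))
      ≈⟨ +-cong (*-congˡ (*-congˡ (det-cong _ _ λ k → A≋B (suc k) (λ ()) ∘ punchIn j)))
                (*-congˡ (*-congˡ (det-cong _ _ λ k → A≋C (suc k) (λ ()) ∘ punchIn j))) ⟩
    s * ((- 1#) ^ toℕ j * B zero j * det (λ k → removeAt (B (suc k)) j)) +
    t * ((- 1#) ^ toℕ j * C zero j * det (λ k → removeAt (C (suc k)) j)) ∎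
  det-linear {suc n} A B C {s} {t} (suc i) A≋B A≋C Aᵢ = sum-linear λ j → begin
    (- 1#) ^ toℕ j * A zero j * det (λ k → removeAt (A (suc k)) j)
      ≈⟨ *-congˡ (det-linear _ _ _ i
           (λ k k≢i → A≋B (suc k) (k≢i ∘ Fin.suc-injective) ∘ punchIn j)
           (λ k k≢i → A≋C (suc k) (k≢i ∘ Fin.suc-injective) ∘ punchIn j)
           (Aᵢ ∘ punchIn j)) ⟩
    (- 1#) ^ toℕ j * A zero j *
      (s * det (λ k → removeAt (B (suc k)) j) + t * det (λ k → removeAt (C (suc k)) j))
      ≈⟨ solve 6 (λ σ a s b t c → σ :* a :* (s :* b :+ t :* c) :=
                    s :* (σ :* a :* b) :+ t :* (σ :* a :* c)) refl _ _ _ _ _ _ ⟩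
    s * ((- 1#) ^ toℕ j * A zero j * det (λ k → removeAt (B (suc k)) j)) +
    t * ((- 1#) ^ toℕ j * A zero j * det (λ k → removeAt (C (suc k)) j))
      ≈⟨ +-cong (*-congˡ (*-congʳ (*-congˡ (A≋B zero (λ ()) j))))
                (*-congˡ (*-congʳ (*-congˡ (A≋C zero (λ ()) j)))) ⟩
    s * ((- 1#) ^ toℕ j * B zero j * det (λ k → removeAt (B (suc k)) j)) +
    t * ((- 1#) ^ toℕ j * C zero j * det (λ k → removeAt (C (suc k)) j)) ∎

  -- In the expansion along both rows, every pair of columns is deleted in two orders. The two terms
  -- agree up to sign when the rows are equal.
  det-first-two : ∀ {n} (A : Matrix (suc (suc n)) (suc (suc n))) →
                  A zero ≋ A (suc zero) → det A ≈ 0#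
  det-first-two {n} A A₀≋A₁ = trans
    (sum-cong-≋ λ j → *-distribˡ-sum {n = suc n} (σ j * A zero j) (λ k → σ k * A (suc zero) (punchIn j k) * D j k))
    (sum-sum-cancel G cancel)
    where
    σ : ∀ {n} → Fin n → Carrier
    σ j = (- 1#) ^ toℕ j

    D : Fin (suc (suc n)) → Fin (suc n) → Carrier
    D j k = det λ r c → A (suc (suc r)) (punchIn j (punchIn k c))

    G : Fin (suc (suc n)) → Fin (suc n) → Carrier
    G j k = σ j * A zero j * (σ k * A (suc zero) (punchIn j k) * D j k)

    cancel : ∀ j k → toℕ j ≤ toℕ k → G (inject₁ j) k + G (suc k) j ≈ 0#
    cancel j k j≤k = begin
      G (inject₁ j) k + G (suc k) j
        ≈⟨ +-cong
             (*-cong (*-cong (reflexive (≡.cong ((- 1#) ^_) (Fin.toℕ-inject₁ j)))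
                             (A₀≋A₁ (inject₁ j)))
                     (*-cong (*-congˡ (trans (reflexive (≡.cong (A (suc zero)) (punchIn-inject₁ j≤k)))
                                             (sym (A₀≋A₁ (suc k)))))
                             (det-cong _ _ λ r c →
                                reflexive (≡.cong (A (suc (suc r))) (punchIn-punchIn j≤k c)))))
             (*-congˡ (*-congʳ (*-congˡ
                (reflexive (≡.cong (A (suc zero)) (punchIn-suc j≤k)))))) ⟩
      σ j * A (suc zero) (inject₁ j) * (σ k * A zero (suc k) * D (suc k) j) +
      (- 1# * σ k) * A zero (suc k) * (σ j * A (suc zero) (inject₁ j) * D (suc k) j)
        -- Here `e` stands for `- 1#`, the extra sign of column k + 1 compared with k, so that both
        -- terms are one product collected with the factor 1 + e.
        ≈⟨ solve 6 (λ e s a t b d → s :* a :* (t :* b :* d) :+ (e :* t) :* b :* (s :* a :* d) :=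
                      (con 1 :+ e) :* (s :* a :* (t :* b :* d)))
             refl (- 1#) (σ j) (A (suc zero) (inject₁ j)) (σ k) (A zero (suc k)) (D (suc k) j) ⟩
      (1# + - 1#) * (σ j * A (suc zero) (inject₁ j) * (σ k * A zero (suc k) * D (suc k) j))
        ≈⟨ *-congʳ (-‿inverseʳ 1#) ⟩
      0# * (σ j * A (suc zero) (inject₁ j) * (σ k * A zero (suc k) * D (suc k) j))
        ≈⟨ zeroˡ _ ⟩
      0# ∎

  -- Expansion along the first row keeps both equal rows in every minor. The vanishing of the minors
  -- is an argument, which leaves the induction on the size to the caller.
  det-alternating-suc : ∀ {n} (A : Matrix (suc n) (suc n)) {i j} →
    (∀ k → A (suc i) ∘ punchIn k ≋ A (suc j) ∘ punchIn k →
           det (λ r → removeAt (A (suc r)) k) ≈ 0#) →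
    A (suc i) ≋ A (suc j) → det A ≈ 0#
  det-alternating-suc A minors≈0 Aᵢ≋Aⱼ = sum-zero λ k →
    trans (*-congˡ {x = (- 1#) ^ toℕ k * A zero k} (minors≈0 k (Aᵢ≋Aⱼ ∘ punchIn k))) (zeroʳ _)

  private
    _[_]←_ : ∀ {n} → Matrix n n → Fin n → Vector Carrier n → Matrix n n
    _[_]←_ = replaceAt Fin._≟_

  det-alternating-zero : ∀ {n} (A : Matrix (suc n) (suc n)) j →
    ((B : Matrix n n) → ∀ {i j} → i ≢ j → B i ≋ B j → det B ≈ 0#) →
    A zero ≋ A (suc j) → det A ≈ 0#
  det-alternating-zero {suc n} A zero    minors≈0 A₀≋Aⱼ = det-first-two A A₀≋Aⱼ
  -- With rows u, v, u at 0, 1, j: adding row 1 to row j and then row j to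
  -- row 1 changes the determinant only by determinants that vanish by the
  -- other cases, and makes rows 1 and j equal.
  det-alternating-zero {suc n} A (suc i) minors≈0 A₀≋Aⱼ = begin
    det A                       ≈⟨ +-identityʳ _ ⟨
    det A + 0#                  ≈⟨ +-cong (*-identityˡ _) (zeroʳ _) ⟨
    1# * det A + 1# * 0#        ≈⟨ +-congˡ (*-congˡ (later (A [ j ]← v) A[j]₁≋A[j]ⱼ)) ⟨
    1# * det A + 1# * det (A [ j ]← v)
      ≈⟨ det-linear M A (A [ j ]← v) j (λ k k≢j c → at (replaceAt-minimal Fin._≟_ A _ k≢j) c)
                      (λ k k≢j c → trans (at (replaceAt-minimal Fin._≟_ A _ k≢j) c)
                                         (sym (at (replaceAt-minimal Fin._≟_ A _ k≢j) c)))
                      (λ c → trans (at (replaceAt-updates Fin._≟_ A j _) c)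
                               (+-cong (trans (A₀≋Aⱼ c) (sym (*-identityˡ _)))
                                 (trans (sym (at (replaceAt-updates Fin._≟_ A j _) c))
                                        (sym (*-identityˡ _))))) ⟨
    det M                       ≈⟨ +-identityˡ _ ⟨
    0# + det M                  ≈⟨ +-cong (zeroʳ _) (*-identityˡ _) ⟨
    1# * 0# + 1# * det M        ≈⟨ +-congʳ (*-congˡ (det-first-two (M [ one ]← u) M[1]₀≋M[1]₁)) ⟨
    1# * det (M [ one ]← u) + 1# * det M
      ≈⟨ det-linear (M [ one ]← u+v) (M [ one ]← u) M one (λ k k≢1 c → trans (at (replaceAt-minimal Fin._≟_ M _ k≢1) c)
                                           (sym (at (replaceAt-minimal Fin._≟_ M _ k≢1) c)))
                        (λ k k≢1 c → at (replaceAt-minimal Fin._≟_ M _ k≢1) c)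
                        (λ c → +-cong (sym (*-identityˡ _)) (sym (*-identityˡ _))) ⟨
    det (M [ one ]← u+v)        ≈⟨ later (M [ one ]← u+v) M[1]₁≋M[1]ⱼ ⟩
    0#                          ∎
    where
    j : Fin (suc (suc n))
    j = suc (suc i)

    one : Fin (suc (suc n))
    one = suc zero

    u v u+v : Vector Carrier (suc (suc n))
    u = A zero
    v = A one
    u+v c = u c + v c

    M : Matrix (suc (suc n)) (suc (suc n))
    M = A [ j ]← u+v

    at : ∀ {u v : Vector Carrier (suc (suc n))} → u ≡ v → u ≋ v
    at eq c = reflexive (≡.cong (λ w → w c) eq)

    later : ∀ B → B one ≋ B j → det B ≈ 0#
    later B = det-alternating-suc B λ k → minors≈0 (λ r → removeAt (B (suc r)) k) {zero} {suc i} λ ()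

    A[j]₁≋A[j]ⱼ : (A [ j ]← v) one ≋ (A [ j ]← v) j
    A[j]₁≋A[j]ⱼ c = sym (at (replaceAt-updates Fin._≟_ A j v) c)

    M[1]₀≋M[1]₁ : (M [ one ]← u) zero ≋ (M [ one ]← u) one
    M[1]₀≋M[1]₁ c = refl

    M[1]₁≋M[1]ⱼ : (M [ one ]← u+v) one ≋ (M [ one ]← u+v) j
    M[1]₁≋M[1]ⱼ c = sym (at (replaceAt-updates Fin._≟_ A j u+v) c)

  det-alternating : ∀ {n} (A : Matrix n n) {i j} → i ≢ j → A i ≋ A j → det A ≈ 0#
  det-alternating {suc n} A {zero}  {zero}  i≢j Aᵢ≋Aⱼ = ⊥-elim (i≢j ≡.refl)
  det-alternating {suc n} A {zero}  {suc j} i≢j Aᵢ≋Aⱼ = det-alternating-zero A j det-alternating Aᵢ≋Aⱼ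
  det-alternating {suc n} A {suc i} {zero}  i≢j Aᵢ≋Aⱼ =
    det-alternating-zero A i det-alternating (sym ∘ Aᵢ≋Aⱼ)
  det-alternating {suc n} A {suc i} {suc j} i≢j Aᵢ≋Aⱼ =
    det-alternating-suc A (λ k → det-alternating _ (i≢j ∘ ≡.cong suc)) Aᵢ≋Aⱼ

-- Binomial coefficients, divided derivatives and divided differences

module _ where
  open ≡ using (refl; sym; trans; cong; cong₂)
  open import Data.Nat.Base using (_+_; _*_)
  open import Relation.Binary.PropositionalEquality.Properties using (module ≡-Reasoning)
  open ≡-Reasoning
  open ℕ-Solver.+-*-Solver

  nC-absorb : ∀ n k → suc k * (suc n C suc k) ≡ suc n * (n C k)
  nC-absorb zero    zero    = refl
  nC-absorb zero    (suc k) = ℕ.*-zeroʳ k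
  nC-absorb (suc n) zero    = begin
    1 * (suc (suc n) C 1)   ≡⟨ ℕ.*-identityˡ _ ⟩
    suc (suc n) C 1         ≡⟨ nC1≡n (suc (suc n)) ⟩
    suc (suc n)             ≡⟨ ℕ.*-identityʳ _ ⟨
    suc (suc n) * 1         ∎
  nC-absorb (suc n) (suc k) = begin
    suc (suc k) * (suc (suc n) C suc (suc k))
      ≡⟨ cong (suc (suc k) *_) (nCk+nC[k+1]≡[n+1]C[k+1] (suc n) (suc k)) ⟨
    suc (suc k) * ((suc n C suc k) + (suc n C suc (suc k)))
      ≡⟨ solve 3 (λ k c d → (con 2 :+ k) :* (c :+ d) := c :+ (con 1 :+ k) :* c :+ (con 2 :+ k) :* d)
           refl k (suc n C suc k) (suc n C suc (suc k)) ⟩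
    (suc n C suc k) + suc k * (suc n C suc k) + suc (suc k) * (suc n C suc (suc k))
      ≡⟨ cong₂ (λ c d → (suc n C suc k) + c + d) (nC-absorb n k) (nC-absorb n (suc k)) ⟩
    (suc n C suc k) + suc n * (n C k) + suc n * (n C suc k)
      ≡⟨ solve 4 (λ n c a b → c :+ (con 1 :+ n) :* a :+ (con 1 :+ n) :* b := c :+ (con 1 :+ n) :* (a :+ b))
           refl n (suc n C suc k) (n C k) (n C suc k) ⟩
    (suc n C suc k) + suc n * ((n C k) + (n C suc k))
      ≡⟨ cong (λ c → (suc n C suc k) + suc n * c) (nCk+nC[k+1]≡[n+1]C[k+1] n k) ⟩
    suc (suc n) * (suc n C suc k) ∎

  -- The variable `d` is n + 1 - k without truncated subtraction, and k = n + 1 is included with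
  -- both sides 0. Adding (n + 1) binom(n, k - 1) to both sides for k > 0 reduces the claim to
  -- Pascal's rule and absorption.
  nC-scale : ∀ d n k → d + k ≡ suc n → suc n * (n C k) ≡ d * (suc n C k)
  nC-scale d n zero    eq = cong (_* 1) (trans (sym eq) (ℕ.+-identityʳ d))
  nC-scale d n (suc k) eq = ℕ.+-cancelʳ-≡ (suc n * (n C k)) _ _ (begin
    suc n * (n C suc k) + suc n * (n C k)
      ≡⟨ solve 3 (λ n a b → n :* a :+ n :* b := n :* (b :+ a)) refl (suc n) (n C suc k) (n C k) ⟩
    suc n * ((n C k) + (n C suc k))   ≡⟨ cong (suc n *_) (nCk+nC[k+1]≡[n+1]C[k+1] n k) ⟩
    suc n * (suc n C suc k)           ≡⟨ cong (_* (suc n C suc k)) eq ⟨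
    (d + suc k) * (suc n C suc k)     ≡⟨ ℕ.*-distribʳ-+ (suc n C suc k) d (suc k) ⟩
    d * (suc n C suc k) + suc k * (suc n C suc k)
      ≡⟨ cong (d * (suc n C suc k) +_) (nC-absorb n k) ⟩
    d * (suc n C suc k) + suc n * (n C k) ∎)

module Differences {c ℓ} (R : CommutativeRing c ℓ) where

  open CommutativeRing R hiding (zero)
  open SemiringSolver commutativeSemiring using (solve; _:=_; _:+_; _:*_; con)
  open SemiringMult semiring using (×-homo-+; ×1-homo-*) renaming (_×_ to _⨯_)
  open import Relation.Binary.Reasoning.Setoid setoid

  ι : ℕ → Carrier
  ι n = n ⨯ 1#

  ι-+ : ∀ m n → ι (m ℕ.+ n) ≈ ι m + ι n
  ι-+ = ×-homo-+ 1#

  ι-* : ∀ m n → ι (m ℕ.* n) ≈ ι m * ι n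
  ι-* = ×1-homo-*

  -- The k-th divided derivative binom(e, k) x^(e − k) of x^e.
  ∂ : ℕ → Carrier → ℕ → Carrier
  ∂ zero    x zero    = 1#
  ∂ (suc k) x zero    = 0#
  ∂ zero    x (suc e) = x * ∂ zero x e
  ∂ (suc k) x (suc e) = x * ∂ (suc k) x e + ∂ k x e

  -- In other words (e - k) binom(e, k) = (k + 1) binom(e, k + 1), free of subtraction. The factor e
  -- is the eigenvalue of t^e under the Euler operator t d/dt; trading it for one more derivative is
  -- what produces a factor x.
  ∂-euler : ∀ e k x → ι e * ∂ k x e ≈ ι k * ∂ k x e + ι (suc k) * x * ∂ (suc k) x e
  ∂-euler zero zero x =
    solve 1 (λ x → con 0 :* con 1 := con 0 :* con 1 :+ (con 1 :+ con 0) :* x :* con 0) refl x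
  ∂-euler zero (suc k) x =
    solve 2 (λ κ x → con 0 :* con 0 := κ :* con 0 :+ (con 1 :+ κ) :* x :* con 0) refl (ι (suc k)) x
  ∂-euler (suc e) zero x = begin
    ι (suc e) * (x * ∂ 0 x e)
      ≈⟨ solve 3 (λ ε x d → (con 1 :+ ε) :* (x :* d) := x :* d :+ x :* (ε :* d)) refl _ _ _ ⟩
    x * ∂ 0 x e + x * (ι e * ∂ 0 x e)
      ≈⟨ +-congˡ (*-congˡ (∂-euler e zero x)) ⟩
    x * ∂ 0 x e + x * (0# * ∂ 0 x e + ι 1 * x * ∂ 1 x e)
      ≈⟨ solve 3 (λ x d d′ →
            x :* d :+ x :* (con 0 :* d :+ (con 1 :+ con 0) :* x :* d′) :=
            con 0 :* (x :* d) :+ (con 1 :+ con 0) :* x :* (x :* d′ :+ d)) refl _ _ _ ⟩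
    0# * (x * ∂ 0 x e) + ι 1 * x * (x * ∂ 1 x e + ∂ 0 x e) ∎
  ∂-euler (suc e) (suc k) x = begin
    ι (suc e) * (x * ∂ (suc k) x e + ∂ k x e)
      ≈⟨ solve 4 (λ ε x d d′ → (con 1 :+ ε) :* (x :* d′ :+ d) :=
            x :* d′ :+ d :+ (x :* (ε :* d′) :+ ε :* d)) refl (ι e) x (∂ k x e) (∂ (suc k) x e) ⟩
    x * ∂ (suc k) x e + ∂ k x e + (x * (ι e * ∂ (suc k) x e) + ι e * ∂ k x e)
      ≈⟨ +-congˡ (+-cong (*-congˡ (∂-euler e (suc k) x)) (∂-euler e k x)) ⟩
    x * ∂ (suc k) x e + ∂ k x e +
      (x * (ι (suc k) * ∂ (suc k) x e + ι (suc (suc k)) * x * ∂ (suc (suc k)) x e) +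
       (ι k * ∂ k x e + ι (suc k) * x * ∂ (suc k) x e))
      ≈⟨ solve 5 (λ κ x d d′ d″ →
            x :* d′ :+ d :+
              (x :* ((con 1 :+ κ) :* d′ :+ (con 1 :+ (con 1 :+ κ)) :* x :* d″) :+
               (κ :* d :+ (con 1 :+ κ) :* x :* d′)) :=
            (con 1 :+ κ) :* (x :* d′ :+ d) :+ (con 1 :+ (con 1 :+ κ)) :* x :* (x :* d″ :+ d′))
           refl (ι k) x (∂ k x e) (∂ (suc k) x e) (∂ (suc (suc k)) x e) ⟩
    ι (suc k) * (x * ∂ (suc k) x e + ∂ k x e) +
      ι (suc (suc k)) * x * (x * ∂ (suc (suc k)) x e + ∂ (suc k) x e) ∎

  -- The divided difference of the function t ↦ t^e at the nodes x (a times)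
  -- and y (b times), with value 0 when there are no nodes.
  module _ (x y : Carrier) where

    private
      δ : ℕ → ℕ → Carrier
      δ zero    zero    = 1#
      δ zero    (suc b) = 0#
      δ (suc a) b       = 0#

    Δ : ℕ → ℕ → ℕ → Carrier
    Δ zero          zero    e       = 0#
    Δ zero          (suc b) e       = ∂ b y e
    Δ (suc a)       b       zero    = δ a b
    -- Leibniz rule for t · t^e at a node x; the value 0 on no nodes makes it hold for the single
    -- node x too.
    Δ (suc a)       b       (suc e) = x * Δ (suc a) b e + Δ a b e

    Δ-zeroʳ : ∀ a e → Δ (suc a) 0 e ≈ ∂ a x e
    Δ-zeroʳ zero    zero    = refl
    Δ-zeroʳ (suc a) zero    = refl
    Δ-zeroʳ zero    (suc e) = trans (+-identityʳ _) (*-congˡ (Δ-zeroʳ zero e))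
    Δ-zeroʳ (suc a) (suc e) = +-cong (*-congˡ (Δ-zeroʳ (suc a) e)) (Δ-zeroʳ a e)

    Δ-zeroˡ-suc : ∀ b e → Δ 0 (suc b) (suc e) ≈ y * Δ 0 (suc b) e + Δ 0 b e
    Δ-zeroˡ-suc zero    e = sym (+-identityʳ _)
    Δ-zeroˡ-suc (suc b) e = refl

    -- Multiplying out (x − y) t[x^(a+1), y^(b+1)] = t[x^(a+1), y^b] − t[x^a, y^(b+1)]
    -- gives an identity of semirings.
    Δ-difference : ∀ a b e → x * Δ (suc a) (suc b) e + Δ a (suc b) e ≈
                             y * Δ (suc a) (suc b) e + Δ (suc a) b e
    -- The Leibniz rule at y instead of x. For a > 0 the left side unfolds at x and the claim
    -- becomes `Δ-difference` with a lowered by one, hence the mutual induction.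
    Δ-suc : ∀ a b e → Δ a (suc b) (suc e) ≈ y * Δ a (suc b) e + Δ a b e

    Δ-difference zero    zero    zero    =
      solve 2 (λ x y → x :* con 0 :+ con 1 := y :* con 0 :+ con 1) refl x y
    Δ-difference zero    (suc b) zero    =
      solve 2 (λ x y → x :* con 0 :+ con 0 := y :* con 0 :+ con 0) refl x y
    Δ-difference (suc a) b       zero    =
      trans (+-cong (zeroʳ x) (Δ₀ a)) (sym (+-congʳ (zeroʳ y)))
      where
      Δ₀ : ∀ a → Δ (suc a) (suc b) 0 ≈ 0#
      Δ₀ zero    = refl
      Δ₀ (suc a) = refl
    Δ-difference a       b       (suc e) = begin
      x * (x * P + Q) + Δ a (suc b) (suc e)   ≈⟨ +-cong (*-congˡ (Δ-difference a b e)) (Δ-suc a b e) ⟩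
      x * (y * P + S) + (y * Q + U)
        ≈⟨ solve 6 (λ x y p q s u → x :* (y :* p :+ s) :+ (y :* q :+ u) :=
                      y :* (x :* p :+ q) :+ (x :* s :+ u)) refl x y P Q S U ⟩
      y * (x * P + Q) + (x * S + U)           ∎
      where
      P = Δ (suc a) (suc b) e
      Q = Δ a (suc b) e
      S = Δ (suc a) b e
      U = Δ a b e

    Δ-suc zero    b e = Δ-zeroˡ-suc b e
    Δ-suc (suc a) b e = Δ-difference a b e

    Δ-expand : ∀ a b e → Δ (suc a) b e ≈ (x - y) * Δ (suc a) (suc b) e + Δ a (suc b) e
    Δ-expand a b e = begin
      S                            ≈⟨ +-identityˡ _ ⟨
      0# + S                       ≈⟨ +-congʳ (zeroˡ P) ⟨
      0# * P + S                   ≈⟨ +-congʳ (*-congʳ (-‿inverseʳ y)) ⟨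
      (y - y) * P + S
        ≈⟨ solve 4 (λ y y′ p s → (y :+ y′) :* p :+ s := y′ :* p :+ (y :* p :+ s)) refl y (- y) P S ⟩
      - y * P + (y * P + S)        ≈⟨ +-congˡ (Δ-difference a b e) ⟨
      - y * P + (x * P + Q)
        ≈⟨ solve 4 (λ x y′ p q → y′ :* p :+ (x :* p :+ q) := (x :+ y′) :* p :+ q) refl x (- y) P Q ⟩
      (x - y) * P + Q              ∎
      where
      P = Δ (suc a) (suc b) e
      Q = Δ a (suc b) e
      S = Δ (suc a) b e

-- Exchanging rows in alternating forms

module Exchange {c ℓ} (R : CommutativeRing c ℓ) where

  open CommutativeRing R hiding (zero)
  open Matrices rawRing
  open Determinant R
  open Differences R
  open SemiringSolver commutativeSemiring using (solve; _:=_; _:+_; _:*_; con)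
  open SemiringExp semiring using (_^_; ^-homo-*)
  open import Relation.Binary.Reasoning.Setoid setoid

  -- A minor seen as a function of a family of rows, in which only the `Valid` keys are rows of the
  -- matrix. The scalars on both sides replace divisions: the multiple of another row contributes
  -- nothing.
  record Alternating {k} {K : Set k} (Valid : K → Set) {n}
                     (φ : (K → Vector Carrier n) → Carrier) : Set (k ⊔ c ⊔ ℓ) where
    field
      exchange : ∀ {A B i j a b t} → Valid i → Valid j → i ≢ j →
                 (∀ k → k ≢ i → A k ≋ B k) →
                 (∀ c → a * A i c ≈ b * B i c + t * A j c) →
                 a * φ A ≈ b * φ B

  private
    _[_]←_ : ∀ {n} → Matrix n n → Fin n → Vector Carrier n → Matrix n n
    _[_]←_ = replaceAt Fin._≟_

  -- By linearity in row i, the summand t A_j gives t times a determinant whose rows i and j agree.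
  det-exchange : ∀ {n} {A B : Matrix n n} {i j a b t} → i ≢ j →
                 (∀ k → k ≢ i → A k ≋ B k) →
                 (∀ c → a * A i c ≈ b * B i c + t * A j c) →
                 a * det A ≈ b * det B
  det-exchange {n} {A} {B} {i} {j} {a} {b} {t} i≢j A≋B Aᵢ = begin
    a * det A                   ≈⟨ +-identityʳ _ ⟨
    a * det A + 0#              ≈⟨ +-congˡ (zeroˡ (det A)) ⟨
    a * det A + 0# * det A      ≈⟨ det-linear aA A A i aA≋A aA≋A aAᵢ ⟨
    det aA                      ≈⟨ det-linear aA B E i
                                     (λ k k≢i c → trans (aA≋A k k≢i c) (A≋B k k≢i c))
                                     (λ k k≢i c → trans (aA≋A k k≢i c)
                                                 (trans (A≋B k k≢i c) (sym (E≋B k k≢i c))))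
                                     (λ c → trans (reflexive (≡.cong (λ v → v c) (replaceAt-updates Fin._≟_ A i _)))
                                                  (trans (Aᵢ c) (+-congˡ (*-congˡ (sym (Eᵢ c)))))) ⟩
    b * det B + t * det E       ≈⟨ +-congˡ (*-congˡ (det-alternating E i≢j λ c →
                                     trans (Eᵢ c) (trans (A≋B j (i≢j ∘ ≡.sym) c)
                                                         (sym (E≋B j (i≢j ∘ ≡.sym) c))))) ⟩
    b * det B + t * 0#          ≈⟨ +-congˡ (zeroʳ t) ⟩
    b * det B + 0#              ≈⟨ +-identityʳ _ ⟩
    b * det B                   ∎
    where
    aA E : Matrix n n
    aA = A [ i ]← (λ c → a * A i c)
    E  = B [ i ]← A j

    aA≋A : ∀ k → k ≢ i → aA k ≋ A k
    aA≋A k k≢i c = reflexive (≡.cong (λ v → v c) (replaceAt-minimal Fin._≟_ A _ k≢i))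

    aAᵢ : ∀ c → aA i c ≈ a * A i c + 0# * A i c
    aAᵢ c = trans (reflexive (≡.cong (λ v → v c) (replaceAt-updates Fin._≟_ A i _)))
                  (sym (trans (+-congˡ (zeroˡ _)) (+-identityʳ _)))

    E≋B : ∀ k → k ≢ i → E k ≋ B k
    E≋B k k≢i c = reflexive (≡.cong (λ v → v c) (replaceAt-minimal Fin._≟_ B _ k≢i))

    Eᵢ : E i ≋ A j
    Eᵢ c = reflexive (≡.cong (λ v → v c) (replaceAt-updates Fin._≟_ B i _))

  minor-alternating : ∀ {k} {K : Set k} {Valid : K → Set} {m n}
                      (key : Fin m → K) → Injective _≡_ _≡_ key →
                      (∀ {κ} → Valid κ → ∃[ i ] key i ≡ κ) →
                      (col : Fin m → Fin n) →
                      Alternating Valid (λ A → det (λ i j → A (key i) (col j)))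
  minor-alternating key key-inj key⁻¹ col .Alternating.exchange {A} {B} {i} {j} vᵢ vⱼ i≢j A≋B Aᵢ
    with key⁻¹ vᵢ | key⁻¹ vⱼ
  ... | i′ , ≡.refl | j′ , ≡.refl =
    det-exchange {A = λ i → A (key i) ∘ col} {B = λ i → B (key i) ∘ col}
      (i≢j ∘ ≡.cong key) (λ k k≢i → A≋B (key k) (k≢i ∘ key-inj) ∘ col) (Aᵢ ∘ col)

  infix 4 _⟿[_]_
  -- Up to a positive integer, p is the extracted factor d times some multiple of q. Storing the
  -- predecessor of the integer makes it nonzero by construction.
  record _⟿[_]_ (p d q : Carrier) : Set (c ⊔ ℓ) where
    constructor factor
    field
      pred-scale : ℕ
      cofactor   : Carrier
      equality   : ι (suc pred-scale) * p ≈ d * (cofactor * q)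

  ⟿-refl : ∀ {p} → p ⟿[ 1# ] p
  ⟿-refl {p} = factor 0 1# (solve 1 (λ p → (con 1 :+ con 0) :* p := con 1 :* (con 1 :* p)) refl p)

  ⟿-trans : ∀ {p q r d e} → p ⟿[ d ] q → q ⟿[ e ] r → p ⟿[ d * e ] r
  ⟿-trans {p} {q} {r} {d} {e} (factor a s eq) (factor b t eq′) =
    -- The first argument is the predecessor of (a + 1)(b + 1).
    factor (b ℕ.+ a ℕ.* suc b) (s * t) (begin
      ι (suc a ℕ.* suc b) * p           ≈⟨ *-congʳ (ι-* (suc a) (suc b)) ⟩
      ι (suc a) * ι (suc b) * p
        ≈⟨ solve 3 (λ a b p → a :* b :* p := b :* (a :* p)) refl (ι (suc a)) (ι (suc b)) p ⟩
      ι (suc b) * (ι (suc a) * p)       ≈⟨ *-congˡ eq ⟩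
      ι (suc b) * (d * (s * q))
        ≈⟨ solve 4 (λ b d s q → b :* (d :* (s :* q)) := d :* (s :* (b :* q))) refl (ι (suc b)) d s q ⟩
      d * (s * (ι (suc b) * q))         ≈⟨ *-congˡ (*-congˡ eq′) ⟩
      d * (s * (e * (t * r)))
        ≈⟨ solve 5 (λ d e s t r → d :* (s :* (e :* (t :* r))) := d :* e :* (s :* t :* r)) refl d e s t r ⟩
      d * e * (s * t * r)               ∎)

  ⟿-resp : ∀ {p q d e} → d ≈ e → p ⟿[ d ] q → p ⟿[ e ] q
  ⟿-resp d≈e (factor a s eq) = factor a s (trans eq (*-congʳ d≈e))

  -- Lets powers of the single variables, which appear on the way to the divided differences,
  -- disappear into the cofactor.
  ⟿-forget : ∀ {p q d} → p ⟿[ d ] q → p ⟿[ 1# ] q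
  ⟿-forget {p} {q} {d} (factor a s eq) =
    factor a (d * s) (trans eq (trans (sym (*-assoc d s q)) (sym (*-identityˡ _))))

  ^-⟿ : ∀ {p q r} x m n → p ⟿[ x ^ m ] q → q ⟿[ x ^ n ] r → p ⟿[ x ^ (m ℕ.+ n) ] r
  ^-⟿ x m n p⟿q q⟿r = ⟿-resp (sym (^-homo-* x m n)) (⟿-trans p⟿q q⟿r)

-- Row reductions inside one block and between two blocks

module Blocks {c ℓ} (R : CommutativeRing c ℓ)
              (L : ℕ) {N : ℕ} (col : Fin N → ℕ) (col≤L : ∀ j → col j ≤ L)
              {m : ℕ} (Valid : Fin m × ℕ → Set)
              {φ : (Fin m × ℕ → Vector (CommutativeRing.Carrier R) N) → CommutativeRing.Carrier R}
              (alternating : Exchange.Alternating R Valid φ) where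

  open CommutativeRing R hiding (zero)
  open Determinant R using (_≋_)
  open Differences R
  open Exchange R
  open Alternating alternating
  open SemiringSolver commutativeSemiring using (solve; _:=_; _:+_; _:*_; con)
  open SemiringExp semiring using (_^_)
  open import Relation.Binary.Reasoning.Setoid setoid

  Rows : Set c
  Rows = Fin m × ℕ → Vector Carrier N

  infix 4 _≟ᵏ_
  _≟ᵏ_ : DecidableEquality (Fin m × ℕ)
  _≟ᵏ_ = ≡-dec Fin._≟_ ℕ._≟_

  private
    _[_]←_ : Rows → Fin m × ℕ → Vector Carrier N → Rows
    _[_]←_ = replaceAt _≟ᵏ_

  updated : ∀ A i v → (A [ i ]← v) i ≋ v
  updated A i v c = reflexive (≡.cong (λ w → w c) (replaceAt-updates _≟ᵏ_ A i v))

  unchanged : ∀ A {i k} v → k ≢ i → (A [ i ]← v) k ≋ A k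
  unchanged A v k≢i c = reflexive (≡.cong (λ w → w c) (replaceAt-minimal _≟ᵏ_ A v k≢i))

  replace-row : ∀ {A i j s d t r v} → Valid i → Valid j → i ≢ j →
                (∀ c → ι (suc s) * A i c ≈ d * t * v c + r * A j c) →
                φ A ⟿[ d ] φ (A [ i ]← v)
  replace-row {A} {i} {s = s} {d} {t} {v = v} vᵢ vⱼ i≢j Aᵢ = factor s t (trans
    (exchange vᵢ vⱼ i≢j (λ k k≢i c → sym (unchanged A v k≢i c))
      (λ c → trans (Aᵢ c) (+-congʳ (*-congˡ (sym (updated A i v c))))))
    (*-assoc d t _))

  -- The k-th divided derivative, at x, of the vector of functions
  -- t ↦ binom(L + i + 1, h) t^(L − h), where h runs over the columns.
  row : Carrier → ℕ → ℕ → Vector Carrier N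
  row x k i j = ι ((L ℕ.+ suc i) C col j) * ∂ k x (L ∸ col j)

  -- Passing from binom(n, h) to binom(n + 1, h), where n = L + i + 1, costs the factor n + 1 - h =
  -- (L - h) + (i + 2). Its part L - h is the exponent of the monomial, to which `∂-euler` applies.
  row-expand : ∀ x k i j →
    ι (suc (L ℕ.+ suc i)) * row x k i j ≈
    x * ι (suc k) * row x (suc k) (suc i) j + ι (suc (suc i) ℕ.+ k) * row x k (suc i) j
  row-expand x k i j = begin
    ι (suc n) * (ι (n C h) * d)         ≈⟨ *-assoc _ _ _ ⟨
    ι (suc n) * ι (n C h) * d           ≈⟨ *-congʳ (ι-* (suc n) (n C h)) ⟨
    ι (suc n ℕ.* (n C h)) * d
      ≈⟨ *-congʳ (reflexive (≡.cong ι (nC-scale (e ℕ.+ suc (suc i)) n h e+i+2+h≡n+1))) ⟩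
    ι ((e ℕ.+ suc (suc i)) ℕ.* (suc n C h)) * d
      ≈⟨ *-congʳ (ι-* (e ℕ.+ suc (suc i)) (suc n C h)) ⟩
    ι (e ℕ.+ suc (suc i)) * C′ * d      ≈⟨ *-congʳ (*-congʳ (ι-+ e (suc (suc i)))) ⟩
    (ι e + ι (suc (suc i))) * C′ * d
      ≈⟨ solve 4 (λ e i c d → (e :+ i) :* c :* d := c :* (e :* d :+ i :* d)) refl (ι e) _ C′ d ⟩
    C′ * (ι e * d + ι (suc (suc i)) * d)
      ≈⟨ *-congˡ (+-congʳ (∂-euler e k x)) ⟩
    C′ * (ι k * d + ι (suc k) * x * d′ + ι (suc (suc i)) * d)
      ≈⟨ solve 7 (λ c k k′ i x d d′ →
            c :* (k :* d :+ k′ :* x :* d′ :+ i :* d) :=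
            x :* k′ :* (c :* d′) :+ (i :+ k) :* (c :* d))
           refl C′ (ι k) (ι (suc k)) (ι (suc (suc i))) x d d′ ⟩
    x * ι (suc k) * (C′ * d′) + (ι (suc (suc i)) + ι k) * (C′ * d)
      ≈⟨ +-congˡ (*-congʳ (ι-+ (suc (suc i)) k)) ⟨
    x * ι (suc k) * (C′ * d′) + ι (suc (suc i) ℕ.+ k) * (C′ * d)
      ≈⟨ +-cong (*-congˡ (*-congʳ C′≈)) (*-congˡ (*-congʳ C′≈)) ⟩
    x * ι (suc k) * row x (suc k) (suc i) j + ι (suc (suc i) ℕ.+ k) * row x k (suc i) j ∎
    where
    n h e : ℕ
    n = L ℕ.+ suc i
    h = col j
    e = L ∸ h
    d d′ C′ : Carrier
    d  = ∂ k x e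
    d′ = ∂ (suc k) x e
    C′ = ι (suc n C h)
    C′≈ : C′ ≈ ι ((L ℕ.+ suc (suc i)) C h)
    C′≈ = reflexive (≡.cong (λ n → ι (n C h)) (≡.sym (ℕ.+-suc L (suc i))))
    e+i+2+h≡n+1 : e ℕ.+ suc (suc i) ℕ.+ h ≡ suc n
    e+i+2+h≡n+1 = ≡.trans (swap e (suc (suc i)) h)
      (≡.trans (≡.cong (ℕ._+ suc (suc i)) (ℕ.m∸n+n≡m (col≤L j))) (ℕ.+-suc L (suc i)))
      where
      open ℕ-Solver.+-*-Solver renaming (solve to solveℕ; _:+_ to _⊕_; _:=_ to _⊜_)
      swap : ∀ a b c → a ℕ.+ b ℕ.+ c ≡ a ℕ.+ c ℕ.+ b
      swap = solveℕ 3 (λ a b c → a ⊕ b ⊕ c ⊜ a ⊕ c ⊕ b) ≡.refl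

  -- In round r the rows from 0 upwards receive their (r + 1)-st derivative,
  -- and s of them already have it; row i is finished after n − i rounds.  A
  -- row that carries k derivatives at position i is row x k (i + k), because
  -- each exchange also raises the index of the function.
  level : ℕ → ℕ → ℕ → ℕ → ℕ
  level n r s i = (if does (i ℕ.<? s) then suc r else r) ⊓ (n ∸ i)

  level-≥ : ∀ n r {s i} → s ≤ i → level n r s i ≡ r ⊓ (n ∸ i)
  level-≥ n r {s} {i} s≤i rewrite dec-false (i ℕ.<? s) (ℕ.≤⇒≯ s≤i) = ≡.refl

  level-< : ∀ n r {s i} → i < s → level n r s i ≡ suc r ⊓ (n ∸ i)
  level-< n r {s} {i} i<s rewrite dec-true (i ℕ.<? s) i<s = ≡.refl

  level-suc : ∀ n r {s i} → i ≢ s → level n r (suc s) i ≡ level n r s i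
  level-suc n r {s} {i} i≢s with ℕ.<-cmp i s
  ... | tri< i<s _ _ = ≡.trans (level-< n r (ℕ.m<n⇒m<1+n i<s)) (≡.sym (level-< n r i<s))
  ... | tri≈ _ i≡s _ = ⊥-elim (i≢s i≡s)
  ... | tri> _ _ s<i = ≡.trans (level-≥ n r s<i) (≡.sym (level-≥ n r (ℕ.<⇒≤ s<i)))

  -- Rows i ≥ n - r already have their final number n - i ≤ r of derivatives, so round r ends after
  -- n - r rows.
  level-round : ∀ n r i → level n r (n ∸ r) i ≡ level n (suc r) 0 i
  level-round n r i with ℕ.<-≤-connex i (n ∸ r)
  ... | inj₁ i<n∸r = level-< n r i<n∸r
  ... | inj₂ n∸r≤i = ≡.trans (level-≥ n r n∸r≤i)
                       (≡.trans (ℕ.m≥n⇒m⊓n≡n n∸i≤r) (≡.sym (ℕ.m≥n⇒m⊓n≡n (ℕ.m≤n⇒m≤1+n n∸i≤r))))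
    where
    n∸i≤r : n ∸ i ≤ r
    n∸i≤r = ℕ.m≤n+o⇒m∸n≤o n i (ℕ.≤-trans (ℕ.m≤n+m∸n n r)
      (ℕ.≤-trans (ℕ.+-monoʳ-≤ r n∸r≤i) (ℕ.≤-reflexive (ℕ.+-comm r i))))

  -- The number of exchanges in the first `t` rounds, with n - r of them in round r.
  triangular : ℕ → ℕ → ℕ
  triangular n zero    = 0
  triangular n (suc t) = triangular n t ℕ.+ (n ∸ t)

  triangular-suc : ∀ n t → triangular (suc n) (suc t) ≡ suc n ℕ.+ triangular n t
  triangular-suc n zero    = ≡.sym (ℕ.+-identityʳ (suc n))
  triangular-suc n (suc t) =
    ≡.trans (≡.cong (ℕ._+ (n ∸ t)) (triangular-suc n t)) (ℕ.+-assoc (suc n) _ (n ∸ t))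

  triangular≡C : ∀ n → triangular n n ≡ suc n C 2
  triangular≡C zero    = ≡.refl
  triangular≡C (suc n) = ≡.trans (triangular-suc n n)
    (≡.trans (≡.cong₂ ℕ._+_ (≡.sym (nC1≡n (suc n))) (triangular≡C n))
             (nCk+nC[k+1]≡[n+1]C[k+1] (suc n) 1))

  module Derivatives (x : Carrier) (p : Fin m) (n : ℕ) (valid : ∀ i → i ≤ n → Valid (p , i)) where

    AtLevels : ℕ → ℕ → Rows → Set ℓ
    AtLevels r s A = ∀ i → i ≤ n → A (p , i) ≋ row x (level n r s i) (i ℕ.+ level n r s i)

    SameElsewhere : Rows → Rows → Set ℓ
    SameElsewhere A B = ∀ k i → k ≢ p → A (k , i) ≋ B (k , i)

    at-level : ∀ r s A {i l} → AtLevels r s A → i ≤ n → level n r s i ≡ l →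
               A (p , i) ≋ row x l (i ℕ.+ l)
    at-level r s A {i} levels i≤n eq =
      ≡.subst (λ l → A (p , i) ≋ row x l (i ℕ.+ l)) eq (levels i i≤n)

    -- Row s is exchanged with the help of row s + 1, which must still carry only r derivatives;
    -- hence a round runs upwards. The bound s + 1 + r ≤ n keeps the raised function index within
    -- the block.
    raise-row : ∀ r s A → suc s ℕ.+ r ≤ n → AtLevels r s A →
                ∃[ B ] AtLevels r (suc s) B × SameElsewhere B A × φ A ⟿[ x ] φ B
    raise-row r s A s+r<n levels = B , levels′ , elsewhere ,
      replace-row {A = A} {s = L ℕ.+ suc (s ℕ.+ r)} (valid s s≤n) (valid (suc s) s<n)
        (λ eq → ℕ.1+n≢n (≡.sym (≡.cong proj₂ eq))) Aₛ
      where
      s<n : s < n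
      s<n = ℕ.m+n≤o⇒m≤o (suc s) s+r<n
      s≤n : s ≤ n
      s≤n = ℕ.<⇒≤ s<n
      r+s<n : suc r ℕ.+ s ≤ n
      r+s<n = ℕ.≤-trans (ℕ.≤-reflexive (≡.cong suc (ℕ.+-comm r s))) s+r<n

      v : Vector Carrier N
      v = row x (suc r) (suc s ℕ.+ r)
      B : Rows
      B = A [ p , s ]← v

      Aₛ : ∀ c → ι (suc (L ℕ.+ suc (s ℕ.+ r))) * A (p , s) c ≈
                 x * ι (suc r) * v c + ι (suc (suc (s ℕ.+ r)) ℕ.+ r) * A (p , suc s) c
      Aₛ c = trans (*-congˡ (at-level r s A levels s≤n level-s c))
               (trans (row-expand x r (s ℕ.+ r) c)
                      (+-congˡ (*-congˡ (sym (at-level r s A levels s<n level-s+1 c)))))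
        where
        level-s : level n r s s ≡ r
        level-s = ≡.trans (level-≥ n r {s} ℕ.≤-refl)
                    (ℕ.m≤n⇒m⊓n≡m (ℕ.m+n≤o⇒m≤o∸n r (ℕ.<⇒≤ r+s<n)))
        level-s+1 : level n r s (suc s) ≡ r
        level-s+1 = ≡.trans (level-≥ n r (ℕ.n≤1+n s))
                      (ℕ.m≤n⇒m⊓n≡m (ℕ.m+n≤o⇒m≤o∸n r (ℕ.≤-trans (ℕ.≤-reflexive (ℕ.+-suc r s)) r+s<n)))

      levels′ : AtLevels r (suc s) B
      levels′ i i≤n c with i ℕ.≟ s
      ... | yes ≡.refl rewrite level-< n r (ℕ.n<1+n i) | ℕ.m≤n⇒m⊓n≡m (ℕ.m+n≤o⇒m≤o∸n (suc r) r+s<n) =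
        trans (updated A (p , i) v c)
              (reflexive (≡.cong (λ k → row x (suc r) k c) (≡.sym (ℕ.+-suc i r))))
      ... | no i≢s rewrite level-suc n r i≢s =
        trans (unchanged A v (i≢s ∘ ≡.cong proj₂) c) (levels i i≤n c)

      elsewhere : SameElsewhere B A
      elsewhere k i k≢p = unchanged A v (k≢p ∘ ≡.cong proj₁)

    raise-rows : ∀ r s A → s ℕ.+ r ≤ n → AtLevels r 0 A →
                 ∃[ B ] AtLevels r s B × SameElsewhere B A × φ A ⟿[ x ^ s ] φ B
    raise-rows r zero    A _     levels = A , levels , (λ k i _ c → refl) , ⟿-refl
    raise-rows r (suc s) A s+r<n levels =
      let B , levelsB , B∼A , A⟿B = raise-rows r s A (ℕ.<⇒≤ s+r<n) levels
          E , levelsE , E∼B , B⟿E = raise-row r s B s+r<n levelsB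
      in  E , levelsE , (λ k i k≢p c → trans (E∼B k i k≢p c) (B∼A k i k≢p c)) ,
          ⟿-resp (*-comm _ x) (⟿-trans A⟿B B⟿E)

    raise-levels : ∀ t A → t ≤ n → AtLevels 0 0 A →
                   ∃[ B ] AtLevels t 0 B × SameElsewhere B A × φ A ⟿[ x ^ triangular n t ] φ B
    raise-levels zero    A _   levels = A , levels , (λ k i _ c → refl) , ⟿-refl
    raise-levels (suc t) A t<n levels =
      let B , levelsB , B∼A , A⟿B = raise-levels t A (ℕ.<⇒≤ t<n) levels
          E , levelsE , E∼B , B⟿E =
            raise-rows t (n ∸ t) B (ℕ.≤-reflexive (ℕ.m∸n+n≡m (ℕ.<⇒≤ t<n))) levelsB
      in  E , (λ i i≤n → at-level t (n ∸ t) E levelsE i≤n (level-round n t i)) ,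
          (λ k i k≢p c → trans (E∼B k i k≢p c) (B∼A k i k≢p c)) ,
          ^-⟿ x (triangular n t) (n ∸ t) A⟿B B⟿E

    -- The derivative order and the position add up to n at the end, so all rows involve the same
    -- function, that of index n. This is what the divided differences require.
    raise-all : ∀ A → (∀ i → i ≤ n → A (p , i) ≋ row x 0 i) →
                ∃[ B ] (∀ a → a ≤ n → B (p , n ∸ a) ≋ row x a n) × SameElsewhere B A ×
                       φ A ⟿[ x ^ (suc n C 2) ] φ B
    raise-all A rows =
      let B , levelsB , B∼A , A⟿B = raise-levels n A ℕ.≤-refl levels₀
      in  B , derivatives B levelsB , B∼A ,
          ≡.subst (λ k → φ A ⟿[ x ^ k ] φ B) (triangular≡C n) A⟿B
      where
      levels₀ : AtLevels 0 0 A
      levels₀ i i≤n c =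
        trans (rows i i≤n c) (reflexive (≡.cong (λ k → row x 0 k c) (≡.sym (ℕ.+-identityʳ i))))

      derivatives : ∀ B → AtLevels n 0 B → ∀ a → a ≤ n → B (p , n ∸ a) ≋ row x a n
      derivatives B levelsB a a≤n c = trans
        (at-level n 0 B levelsB (ℕ.m∸n≤m n a)
          (≡.trans (level-≥ n n {0} {n ∸ a} z≤n)
            (≡.trans (≡.cong (n ⊓_) (ℕ.m∸[m∸n]≡n a≤n)) (ℕ.m≥n⇒m⊓n≡n a≤n))) c)
        (reflexive (≡.cong (λ k → row x a k c) (ℕ.m∸n+n≡m a≤n)))

  module DividedDifferences (x y : Carrier) {p q : Fin m} (p≢q : p ≢ q) (n : ℕ)
           (valid-p : ∀ i → i ≤ n → Valid (p , i)) (valid-q : ∀ i → i ≤ n → Valid (q , i)) where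

    difference : ℕ → ℕ → Vector Carrier N
    difference a b j = ι ((L ℕ.+ suc n) C col j) * Δ x y a b (L ∸ col j)

    difference-expand : ∀ a b j → ι 1 * difference (suc a) b j ≈
                        (x - y) * 1# * difference (suc a) (suc b) j + 1# * difference a (suc b) j
    difference-expand a b j = trans (*-congˡ (*-congˡ (Δ-expand x y a b (L ∸ col j))))
      (solve 4 (λ c π d e → (con 1 :+ con 0) :* (c :* (π :* d :+ e)) :=
                            π :* con 1 :* (c :* d) :+ con 1 :* (c :* e))
             refl (ι ((L ℕ.+ suc n) C col j)) (x - y) _ _)

    -- In round b the rows of the p-block, taken from the last one upwards,
    -- receive their (b + 1)-st node y; s of them already have it.
    record AtDifferences (b s : ℕ) (A : Rows) : Set ℓ where
      field
        done  : ∀ a → a ≤ n → a < s → A (p , n ∸ a) ≋ difference (suc a) (suc b)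
        todo  : ∀ a → a ≤ n → s ≤ a → A (p , n ∸ a) ≋ difference (suc a) b
        fixed : ∀ a → a ≤ n → A (q , n ∸ a) ≋ difference 0 (suc a)
    open AtDifferences

    -- The remainder f[x^s, y^(b+1)] of the recurrence must itself be a row at this moment. For s =
    -- 0 it has only nodes y and is a row of the untouched q-block; for s > 0 it is the row finished
    -- just before in the same round.
    predecessor : ∀ {b s A} → b ≤ n → s ≤ n → AtDifferences b s A →
                  ∃[ j ] Valid j × (p , n ∸ s) ≢ j × A j ≋ difference s (suc b)
    predecessor {b} {zero}  b≤n _   inv =
      (q , n ∸ b) , valid-q _ (ℕ.m∸n≤m n b) , p≢q ∘ ≡.cong proj₁ , fixed inv b b≤n
    predecessor {b} {suc s} b≤n s<n inv =
      (p , n ∸ s) , valid-p _ (ℕ.m∸n≤m n s) ,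
      (λ eq → ℕ.1+n≢n (ℕ.∸-cancelˡ-≡ s<n (ℕ.<⇒≤ s<n) (≡.cong proj₂ eq))) ,
      done inv s (ℕ.<⇒≤ s<n) ℕ.≤-refl

    subtract-row : ∀ b s A → b ≤ n → s ≤ n → AtDifferences b s A →
                   ∃[ B ] AtDifferences b (suc s) B × φ A ⟿[ x - y ] φ B
    subtract-row b s A b≤n s≤n inv = B , inv′ , A⟿B
      where
      v : Vector Carrier N
      v = difference (suc s) (suc b)
      B : Rows
      B = A [ p , n ∸ s ]← v

      A⟿B : φ A ⟿[ x - y ] φ B
      A⟿B with predecessor b≤n s≤n inv
      ... | j , valid-j , s≢j , Aⱼ =
        replace-row {A = A} {s = 0} {t = 1#} {r = 1#} (valid-p _ (ℕ.m∸n≤m n s)) valid-j s≢j λ c →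
          trans (*-congˡ (todo inv s s≤n ℕ.≤-refl c))
                (trans (difference-expand s b c) (+-congˡ (*-congˡ (sym (Aⱼ c)))))

      other : ∀ {a} → a ≤ n → a ≢ s → B (p , n ∸ a) ≋ A (p , n ∸ a)
      other a≤n a≢s = unchanged A v (a≢s ∘ ℕ.∸-cancelˡ-≡ a≤n s≤n ∘ ≡.cong proj₂)

      inv′ : AtDifferences b (suc s) B
      inv′ .done a a≤n (s≤s a≤s) c with a ℕ.≟ s
      ... | yes ≡.refl = updated A (p , n ∸ s) v c
      ... | no  a≢s    = trans (other a≤n a≢s c) (done inv a a≤n (ℕ.≤∧≢⇒< a≤s a≢s) c)
      inv′ .todo a a≤n s<a c =
        trans (other a≤n (ℕ.<⇒≢ s<a ∘ ≡.sym) c) (todo inv a a≤n (ℕ.<⇒≤ s<a) c)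
      inv′ .fixed a a≤n c =
        trans (unchanged A v (p≢q ∘ ≡.sym ∘ ≡.cong proj₁) c) (fixed inv a a≤n c)

    subtract-rows : ∀ b s A → b ≤ n → s ≤ suc n → AtDifferences b 0 A →
                    ∃[ B ] AtDifferences b s B × φ A ⟿[ (x - y) ^ s ] φ B
    subtract-rows b zero    A _   _         inv = A , inv , ⟿-refl
    subtract-rows b (suc s) A b≤n (s≤s s≤n) inv =
      let B , invB , A⟿B = subtract-rows b s A b≤n (ℕ.m≤n⇒m≤1+n s≤n) inv
          E , invE , B⟿E = subtract-row b s B b≤n s≤n invB
      in  E , invE , ⟿-resp (*-comm _ (x - y)) (⟿-trans A⟿B B⟿E)

    next-node : ∀ {b A} → AtDifferences b (suc n) A → AtDifferences (suc b) 0 A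
    next-node inv .done  a a≤n ()
    next-node inv .todo  a a≤n _ = done inv a a≤n (s≤s a≤n)
    next-node inv .fixed = fixed inv

    subtract-all : ∀ b A → b ≤ suc n → AtDifferences 0 0 A →
                   ∃[ B ] AtDifferences b 0 B × φ A ⟿[ (x - y) ^ (b ℕ.* suc n) ] φ B
    subtract-all zero    A _         inv = A , inv , ⟿-refl
    subtract-all (suc b) A (s≤s b≤n) inv =
      let B , invB , A⟿B = subtract-all b A (ℕ.m≤n⇒m≤1+n b≤n) inv
          E , invE , B⟿E = subtract-rows b (suc n) B b≤n ℕ.≤-refl invB
      in  E , next-node invE ,
          ≡.subst (λ k → φ A ⟿[ (x - y) ^ k ] φ E) (ℕ.+-comm (b ℕ.* suc n) (suc n))
                  (^-⟿ (x - y) (b ℕ.* suc n) (suc n) A⟿B B⟿E)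

  variable-power : ∀ x p n → (∀ i → i ≤ n → Valid (p , i)) →
                   ∀ A → (∀ i → i ≤ n → A (p , i) ≋ row x 0 i) →
                   ∃[ q ] φ A ⟿[ x ^ (suc n C 2) ] q
  variable-power x p n valid A rows =
    let B , _ , _ , A⟿B = Derivatives.raise-all x p n valid A rows in φ B , A⟿B

  difference-power : ∀ x y {p q} → p ≢ q → ∀ n →
                     (∀ i → i ≤ n → Valid (p , i)) → (∀ i → i ≤ n → Valid (q , i)) →
                     ∀ A → (∀ i → i ≤ n → A (p , i) ≋ row x 0 i) →
                           (∀ i → i ≤ n → A (q , i) ≋ row y 0 i) →
                     ∃[ r ] φ A ⟿[ (x - y) ^ (suc n ℕ.* suc n) ] r
  difference-power x y {p} {q} p≢q n valid-p valid-q A rows-p rows-q =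
    let B , derivativesB , B∼A , A⟿B = Derivatives.raise-all x p n valid-p A rows-p
        E , derivativesE , E∼B , B⟿E = Derivatives.raise-all y q n valid-q B
          (λ i i≤n c → trans (B∼A q i (p≢q ∘ ≡.sym) c) (rows-q i i≤n c))
        -- Before the first round no row of the p-block has a node y: its divided derivatives of
        -- order a are the differences on a + 1 nodes x. Those of the q-block are differences on
        -- nodes y by definition of `Δ`.
        F , _ , E⟿F = subtract-all (suc n) E ℕ.≤-refl record
          { done  = λ a a≤n ()
          ; todo  = λ a a≤n _ c → trans (E∼B p (n ∸ a) p≢q c)
                      (trans (derivativesB a a≤n c) (*-congˡ (sym (Δ-zeroʳ x y a _))))
          ; fixed = λ a a≤n → derivativesE a a≤n
          }
    in  φ F , ⟿-resp (trans (*-congʳ (*-identityˡ 1#)) (*-identityˡ _))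
                (⟿-trans (⟿-trans (⟿-forget A⟿B) (⟿-forget B⟿E)) E⟿F)
    where open DividedDifferences x y p≢q n valid-p valid-q

-- Elements that are regular, or regular modulo another element

module Divisibility {c ℓ} (R : CommutativeRing c ℓ) where

  open CommutativeRing R hiding (zero)
  open MagmaDefs *-rawMagma using (_∣_; _,_)
  open SemiringDefs (Semiring.rawSemiring semiring) using (_^_; product)
  open SemiringSolver commutativeSemiring using (solve; _:=_; _:+_; _:*_; con)
  open AbelianGroupProperties +-abelianGroup using (x∙y⁻¹≈ε⇒x≈y; x≈y⇒x∙y⁻¹≈ε)
  open RingProperties ring using (-‿distribʳ-*; -‿distribˡ-*)
  open import Relation.Binary.Reasoning.Setoid setoid

  record Regular (q : Carrier) : Set (c ⊔ ℓ) where
    field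
      annihilate : ∀ p → q * p ≈ 0# → p ≈ 0#
  open Regular

  regular-resp : ∀ {q r} → q ≈ r → Regular q → Regular r
  regular-resp q≈r reg .annihilate p rp≈0 = annihilate reg p (trans (*-congʳ q≈r) rp≈0)

  regular-neg : ∀ {q} → Regular q → Regular (- q)
  regular-neg {q} reg .annihilate p -qp≈0 = annihilate reg p (begin
    q * p          ≈⟨ +-identityˡ _ ⟨
    0# + q * p     ≈⟨ +-congʳ (trans (-‿distribˡ-* q p) -qp≈0) ⟨
    - (q * p) + q * p ≈⟨ -‿inverseˡ (q * p) ⟩
    0#             ∎)

  regular-cancel : ∀ {q p r} → Regular q → q * p ≈ q * r → p ≈ r
  regular-cancel {q} {p} {r} reg qp≈qr = x∙y⁻¹≈ε⇒x≈y p r (annihilate reg (p - r) (begin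
    q * (p - r)           ≈⟨ distribˡ q p (- r) ⟩
    q * p + q * - r       ≈⟨ +-congˡ (-‿distribʳ-* q r) ⟨
    q * p - q * r         ≈⟨ x≈y⇒x∙y⁻¹≈ε qp≈qr ⟩
    0#                    ∎))

  regular-1 : Regular 1#
  regular-1 .annihilate p 1p≈0 = trans (sym (*-identityˡ p)) 1p≈0

  regular-* : ∀ {q r} → Regular q → Regular r → Regular (q * r)
  regular-* reg-q reg-r .annihilate p qrp≈0 = annihilate reg-r p (annihilate reg-q _ (trans (sym (*-assoc _ _ p)) qrp≈0))

  regular-^ : ∀ {q} n → Regular q → Regular (q ^ n)
  regular-^ zero    reg = regular-1
  regular-^ (suc n) reg = regular-* reg (regular-^ n reg)

  regular-product : ∀ {n} {d : Vector Carrier n} → (∀ i → Regular (d i)) → Regular (product d)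
  regular-product {zero}  reg = regular-1
  regular-product {suc n} reg = regular-* (reg zero) (regular-product (reg ∘ suc))

  -- q is not a zero divisor modulo d.
  record Coprime (q d : Carrier) : Set (c ⊔ ℓ) where
    field
      cancel : ∀ p → d ∣ q * p → d ∣ p
  open Coprime

  coprime-resp : ∀ {q r d e} → q ≈ r → d ≈ e → Coprime q d → Coprime r e
  coprime-resp q≈r d≈e coprime .cancel p (s , se≈rp) =
    let t , td≈p = cancel coprime p (s , trans (*-congˡ d≈e) (trans se≈rp (*-congʳ (sym q≈r))))
    in  t , trans (*-congˡ (sym d≈e)) td≈p

  coprime-1ˡ : ∀ {d} → Coprime 1# d
  coprime-1ˡ .cancel p (s , sd≈1p) = s , trans sd≈1p (*-identityˡ p)

  coprime-1ʳ : ∀ {q} → Coprime q 1#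
  coprime-1ʳ .cancel p _ = p , *-identityʳ p

  coprime-*ˡ : ∀ {q r d} → Coprime q d → Coprime r d → Coprime (q * r) d
  coprime-*ˡ cop-q cop-r .cancel p (s , sd≈qrp) = cancel cop-r p (cancel cop-q _ (s , trans sd≈qrp (*-assoc _ _ p)))

  -- Cancelling q modulo d gives p = u d. Regularity of d then allows division of the whole relation
  -- by d, so that e divides q u and q cancels again.
  coprime-*ʳ : ∀ {q d e} → Regular d → Coprime q d → Coprime q e → Coprime q (d * e)
  coprime-*ʳ {q} {d} {e} reg cop-d cop-e .cancel p (s , sde≈qp)
    with u , ud≈p ← cancel cop-d p (s * e , trans (solve 3 (λ s d e → s :* e :* d := s :* (d :* e)) refl s d e) sde≈qp)
    with v , ve≈u ← cancel cop-e u (s , regular-cancel reg (begin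
      d * (s * e)   ≈⟨ solve 3 (λ s d e → d :* (s :* e) := s :* (d :* e)) refl s d e ⟩
      s * (d * e)   ≈⟨ sde≈qp ⟩
      q * p         ≈⟨ *-congˡ ud≈p ⟨
      q * (u * d)   ≈⟨ solve 3 (λ q u d → q :* (u :* d) := d :* (q :* u)) refl q u d ⟩
      d * (q * u)   ∎)) =
    v , (begin
      v * (d * e)   ≈⟨ solve 3 (λ v d e → v :* (d :* e) := v :* e :* d) refl v d e ⟩
      v * e * d     ≈⟨ *-congʳ ve≈u ⟩
      u * d         ≈⟨ ud≈p ⟩
      p             ∎)

  coprime-^ˡ : ∀ {q d} n → Coprime q d → Coprime (q ^ n) d
  coprime-^ˡ zero    coprime = coprime-1ˡ
  coprime-^ˡ (suc n) coprime = coprime-*ˡ coprime (coprime-^ˡ n coprime)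

  coprime-^ʳ : ∀ {q d} n → Regular d → Coprime q d → Coprime q (d ^ n)
  coprime-^ʳ zero    reg coprime = coprime-1ʳ
  coprime-^ʳ (suc n) reg coprime = coprime-*ʳ reg coprime (coprime-^ʳ n reg coprime)

  coprime-productˡ : ∀ {n} {q : Vector Carrier n} {d} → (∀ i → Coprime (q i) d) → Coprime (product q) d
  coprime-productˡ {zero}  coprime = coprime-1ˡ
  coprime-productˡ {suc n} coprime = coprime-*ˡ (coprime zero) (coprime-productˡ (coprime ∘ suc))

  coprime-productʳ : ∀ {n} {d : Vector Carrier n} {q} → (∀ i → Regular (d i)) →
                     (∀ i → Coprime q (d i)) → Coprime q (product d)
  coprime-productʳ {zero}  reg coprime = coprime-1ʳ
  coprime-productʳ {suc n} reg coprime =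
    coprime-*ʳ (reg zero) (coprime zero) (coprime-productʳ (reg ∘ suc) (coprime ∘ suc))

  -- If p = s d, then e divides d s, and d cancels modulo e.
  *-∣ : ∀ {d e p} → Coprime d e → d ∣ p → e ∣ p → d * e ∣ p
  *-∣ {d} {e} {p} coprime (s , sd≈p) (t , te≈p)
    with u , ue≈s ← cancel coprime s (t , trans te≈p (trans (sym sd≈p) (*-comm s d))) =
    u , (begin
      u * (d * e)   ≈⟨ solve 3 (λ u d e → u :* (d :* e) := u :* e :* d) refl u d e ⟩
      u * e * d     ≈⟨ *-congʳ ue≈s ⟩
      s * d         ≈⟨ sd≈p ⟩
      p             ∎)

  product-∣ : ∀ {n} {d : Vector Carrier n} {p} → (∀ i → Regular (d i)) →
              (∀ {i j} → i ≢ j → Coprime (d i) (d j)) → (∀ i → d i ∣ p) → product d ∣ p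
  product-∣ {zero}  {p = p} reg coprime d∣p = p , *-identityʳ p
  product-∣ {suc n} reg coprime d∣p =
    *-∣ (coprime-productʳ (reg ∘ suc) (λ i → coprime λ ())) (d∣p zero)
        (product-∣ (reg ∘ suc) (λ i≢j → coprime (i≢j ∘ Fin.suc-injective)) (d∣p ∘ suc))

  module _ (π : Carrier) where

    infix 4 _≡ᵐ_
    _≡ᵐ_ : Carrier → Carrier → Set (c ⊔ ℓ)
    p ≡ᵐ q = ∃[ s ] p ≈ s * π + q

    ≡ᵐ-refl : ∀ {p} → p ≡ᵐ p
    ≡ᵐ-refl {p} = 0# , solve 2 (λ π p → p := con 0 :* π :+ p) refl π p

    ≡ᵐ-resp : ∀ {p q r s} → p ≈ r → q ≈ s → p ≡ᵐ q → r ≡ᵐ s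
    ≡ᵐ-resp p≈r q≈s (t , eq) = t , trans (sym p≈r) (trans eq (+-congˡ q≈s))

    ≡ᵐ-+ : ∀ {p q r s} → p ≡ᵐ q → r ≡ᵐ s → p + r ≡ᵐ q + s
    ≡ᵐ-+ {q = q} {s = s} (t , eq) (u , eq′) = t + u , trans (+-cong eq eq′)
      (solve 5 (λ π t u q s → t :* π :+ q :+ (u :* π :+ s) := (t :+ u) :* π :+ (q :+ s)) refl π t u q s)

    ≡ᵐ-* : ∀ {p q r s} → p ≡ᵐ q → r ≡ᵐ s → p * r ≡ᵐ q * s
    ≡ᵐ-* {q = q} {s = s} (t , eq) (u , eq′) = t * u * π + t * s + q * u , trans (*-cong eq eq′)
      (solve 5 (λ π t u q s → (t :* π :+ q) :* (u :* π :+ s) :=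
                  (t :* u :* π :+ t :* s :+ q :* u) :* π :+ q :* s) refl π t u q s)

    ≡ᵐ-^ : ∀ {p q} n → p ≡ᵐ q → p ^ n ≡ᵐ q ^ n
    ≡ᵐ-^ zero    p≡q = ≡ᵐ-refl
    ≡ᵐ-^ (suc n) p≡q = ≡ᵐ-* p≡q (≡ᵐ-^ n p≡q)

    ≡ᵐ-0 : ∀ {p q} → p ≡ᵐ q → q ≈ 0# → π ∣ p
    ≡ᵐ-0 (s , eq) q≈0 = s , sym (trans eq (trans (+-congˡ q≈0) (+-identityʳ _)))

-- The polynomial ring

open import Defs
open import Data.Integer.Base as ℤ using (ℤ; +_; 0ℤ; 1ℤ)

module _ {m : ℕ} where

  open ≡ using (refl; sym; trans; cong; cong₂)
  open _≈_
  open ≡-Reasoning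

  Exponent : Set
  Exponent = Vec ℕ m

  infixl 6 _⊕_
  _⊕_ : Exponent → Exponent → Exponent
  _⊕_ = Vec.zipWith ℕ._+_

  ⊕-comm : ∀ d e → d ⊕ e ≡ e ⊕ d
  ⊕-comm = Vec.zipWith-comm ℕ.+-comm

  ⊕-assoc : ∀ d e f → (d ⊕ e) ⊕ f ≡ d ⊕ (e ⊕ f)
  ⊕-assoc = Vec.zipWith-assoc ℕ.+-assoc

  ⊕-identityˡ : ∀ d → Vec.replicate m 0 ⊕ d ≡ d
  ⊕-identityˡ = Vec.zipWith-identityˡ ℕ.+-identityˡ

  infix 4 _≟ᵉ_
  _≟ᵉ_ : (d e : Exponent) → Dec (d ≡ e)
  _≟ᵉ_ = Vec.≡-dec ℕ._≟_

  -- The value at p of the linear functional that takes the monomial with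
  -- exponent d to F d.
  ⟨_,_⟩ : ℤ[α] m → (Exponent → ℤ) → ℤ
  ⟨ []          , F ⟩ = 0ℤ
  ⟨ (a , d) ∷ p , F ⟩ = a ℤ.* F d ℤ.+ ⟨ p , F ⟩

  [_≟_] : Exponent → Exponent → ℤ
  [ e ≟ d ] = if does (d ≟ᵉ e) then 1ℤ else 0ℤ

  coeff≡⟨⟩ : ∀ p e → coeff p e ≡ ⟨ p , [ e ≟_] ⟩
  coeff≡⟨⟩ []            e = refl
  coeff≡⟨⟩ ((a , d) ∷ p) e = cong₂ ℤ._+_ (if-* (does (d ≟ᵉ e))) (coeff≡⟨⟩ p e)
    where
    if-* : ∀ b → (if b then a else 0ℤ) ≡ a ℤ.* (if b then 1ℤ else 0ℤ)
    if-* true  = sym (ℤ.*-identityʳ a)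
    if-* false = sym (ℤ.*-zeroʳ a)

  ⟨⟩-cong : ∀ p {F G} → (∀ d → F d ≡ G d) → ⟨ p , F ⟩ ≡ ⟨ p , G ⟩
  ⟨⟩-cong []            F≗G = refl
  ⟨⟩-cong ((a , d) ∷ p) F≗G = cong₂ ℤ._+_ (cong (a ℤ.*_) (F≗G d)) (⟨⟩-cong p F≗G)

  ⟨⟩-zero : ∀ p → ⟨ p , (λ _ → 0ℤ) ⟩ ≡ 0ℤ
  ⟨⟩-zero []            = refl
  ⟨⟩-zero ((a , d) ∷ p) = cong₂ ℤ._+_ (ℤ.*-zeroʳ a) (⟨⟩-zero p)

  ⟨⟩-linear : ∀ p a F G → ⟨ p , (λ d → a ℤ.* F d ℤ.+ G d) ⟩ ≡ a ℤ.* ⟨ p , F ⟩ ℤ.+ ⟨ p , G ⟩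
  ⟨⟩-linear []            a F G = sym (trans (ℤ.+-identityʳ _) (ℤ.*-zeroʳ a))
  ⟨⟩-linear ((b , d) ∷ p) a F G = trans
    (cong (ℤ._+_ (b ℤ.* (a ℤ.* F d ℤ.+ G d))) (⟨⟩-linear p a F G))
    (solve 6 (λ a b f g s t → b :* (a :* f :+ g) :+ (a :* s :+ t) :=
                a :* (b :* f :+ s) :+ (b :* g :+ t)) refl a b (F d) (G d) _ _)
    where open ℤ-Solver.+-*-Solver

  ⟨⟩-swap : ∀ p q (F : Exponent → Exponent → ℤ) →
            ⟨ p , (λ d → ⟨ q , F d ⟩) ⟩ ≡ ⟨ q , (λ e → ⟨ p , (λ d → F d e) ⟩) ⟩
  ⟨⟩-swap []            q F = sym (⟨⟩-zero q)
  ⟨⟩-swap ((a , d) ∷ p) q F =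
    trans (cong (ℤ._+_ (a ℤ.* ⟨ q , F d ⟩)) (⟨⟩-swap p q F)) (sym (⟨⟩-linear q a (F d) _))

  ⟨⟩-+ : ∀ p q F → ⟨ p + q , F ⟩ ≡ ⟨ p , F ⟩ ℤ.+ ⟨ q , F ⟩
  ⟨⟩-+ []            q F = sym (ℤ.+-identityˡ _)
  ⟨⟩-+ ((a , d) ∷ p) q F =
    trans (cong (ℤ._+_ (a ℤ.* F d)) (⟨⟩-+ p q F)) (sym (ℤ.+-assoc (a ℤ.* F d) _ _))

  ⟨⟩-neg : ∀ p F → ⟨ - p , F ⟩ ≡ ℤ.- ⟨ p , F ⟩
  ⟨⟩-neg []            F = refl
  ⟨⟩-neg ((a , d) ∷ p) F = trans
    (cong₂ ℤ._+_ (sym (ℤ.neg-distribˡ-* a (F d))) (⟨⟩-neg p F))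
    (sym (ℤ.neg-distrib-+ (a ℤ.* F d) _))

  ⟨⟩-term : ∀ a d q F → ⟨ List.map (λ (b , e) → a ℤ.* b , d ⊕ e) q , F ⟩ ≡
                        a ℤ.* ⟨ q , (λ e → F (d ⊕ e)) ⟩
  ⟨⟩-term a d []            F = sym (ℤ.*-zeroʳ a)
  ⟨⟩-term a d ((b , e) ∷ q) F = trans
    (cong₂ ℤ._+_ (ℤ.*-assoc a b _) (⟨⟩-term a d q F))
    (sym (ℤ.*-distribˡ-+ a (b ℤ.* F (d ⊕ e)) _))

  -- A product becomes an iterated functional, so that commutativity of the ring is an exchange of
  -- two finite sums.
  ⟨⟩-* : ∀ p q F → ⟨ p * q , F ⟩ ≡ ⟨ p , (λ d → ⟨ q , (λ e → F (d ⊕ e)) ⟩) ⟩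
  ⟨⟩-* []            q F = refl
  ⟨⟩-* ((a , d) ∷ p) q F = trans (⟨⟩-+ (List.map _ q) (p * q) F)
                                 (cong₂ ℤ._+_ (⟨⟩-term a d q F) (⟨⟩-* p q F))

  remove : Exponent → ℤ[α] m → ℤ[α] m
  remove d []            = []
  remove d ((b , e) ∷ p) = if does (e ≟ᵉ d) then remove d p else (b , e) ∷ remove d p

  length-remove : ∀ d p → length (remove d p) ≤ length p
  length-remove d []            = z≤n
  length-remove d ((b , e) ∷ p) with e ≟ᵉ d
  ... | yes _ = ℕ.m≤n⇒m≤1+n (length-remove d p)
  ... | no  _ = s≤s (length-remove d p)

  ⟨⟩-remove : ∀ d p F → ⟨ p , F ⟩ ≡ coeff p d ℤ.* F d ℤ.+ ⟨ remove d p , F ⟩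
  ⟨⟩-remove d []            F = refl
  ⟨⟩-remove d ((b , e) ∷ p) F with e ≟ᵉ d
  ... | yes refl = trans (cong (ℤ._+_ (b ℤ.* F d)) (⟨⟩-remove d p F))
    (solve 4 (λ b f c r → b :* f :+ (c :* f :+ r) := (b :+ c) :* f :+ r)
           refl b (F d) (coeff p d) ⟨ remove d p , F ⟩)
    where open ℤ-Solver.+-*-Solver
  ... | no  _    = trans (cong (ℤ._+_ (b ℤ.* F e)) (⟨⟩-remove d p F))
    (solve 4 (λ b f c r → b :+ (c :* f :+ r) := (con 0ℤ :+ c) :* f :+ (b :+ r))
           refl (b ℤ.* F e) (F d) (coeff p d) ⟨ remove d p , F ⟩)
    where open ℤ-Solver.+-*-Solver

  coeff-remove : ∀ d p e → coeff p e ≡ 0ℤ → coeff (remove d p) e ≡ 0ℤ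
  coeff-remove d p e pₑ≡0 with d ≟ᵉ e
  ... | yes refl = remove-self p
    where
    remove-self : ∀ p → coeff (remove d p) d ≡ 0ℤ
    remove-self []            = refl
    remove-self ((b , f) ∷ p) with f ≟ᵉ d in eq
    ... | yes _ = remove-self p
    ... | no  f≢d rewrite dec-false (f ≟ᵉ d) f≢d = trans (ℤ.+-identityˡ _) (remove-self p)
  ... | no d≢e = trans (remove-other p) pₑ≡0
    where
    remove-other : ∀ p → coeff (remove d p) e ≡ coeff p e
    remove-other []            = refl
    remove-other ((b , f) ∷ p) with f ≟ᵉ d
    ... | yes refl rewrite dec-false (d ≟ᵉ e) d≢e = trans (remove-other p) (sym (ℤ.+-identityˡ _))
    ... | no  _    = cong (ℤ._+_ (if does (f ≟ᵉ e) then b else 0ℤ)) (remove-other p)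

  -- All terms with the exponent of the head together contribute its collected coefficient, which is
  -- 0. Removing them may shorten the list by more than one, so the induction is on a bound for the
  -- length.
  ⟨⟩-coeff-zero : ∀ n p → length p ≤ n → (∀ e → coeff p e ≡ 0ℤ) → ∀ F → ⟨ p , F ⟩ ≡ 0ℤ
  ⟨⟩-coeff-zero n       []            _         p≡0 F = refl
  ⟨⟩-coeff-zero (suc n) ((a , d) ∷ p) (s≤s p≤n) p≡0 F = trans (⟨⟩-remove d ((a , d) ∷ p) F)
    (cong₂ ℤ._+_ (cong (ℤ._* F d) (p≡0 d))
      (⟨⟩-coeff-zero n (remove d ((a , d) ∷ p)) shorter
        (λ e → coeff-remove d ((a , d) ∷ p) e (p≡0 e)) F))
    where
    shorter : length (remove d ((a , d) ∷ p)) ≤ n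
    shorter rewrite dec-true (d ≟ᵉ d) refl = ℕ.≤-trans (length-remove d p) p≤n

  from-⟨⟩ : ∀ {p q : ℤ[α] m} → (∀ F → ⟨ p , F ⟩ ≡ ⟨ q , F ⟩) → p ≈ q
  from-⟨⟩ {p} {q} eq .coeff-≡ e = trans (coeff≡⟨⟩ p e) (trans (eq _) (sym (coeff≡⟨⟩ q e)))

  -- Functionals see only collected coefficients. Operations on lists of terms respect `≈` for this
  -- reason, since their effect on functionals is known.
  to-⟨⟩ : ∀ {p q : ℤ[α] m} → p ≈ q → ∀ F → ⟨ p , F ⟩ ≡ ⟨ q , F ⟩
  to-⟨⟩ {p} {q} p≈q F = ℤ.i-j≡0⇒i≡j _ _ (begin
    ⟨ p , F ⟩ ℤ.- ⟨ q , F ⟩     ≡⟨ cong (ℤ._+_ ⟨ p , F ⟩) (⟨⟩-neg q F) ⟨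
    ⟨ p , F ⟩ ℤ.+ ⟨ - q , F ⟩   ≡⟨ ⟨⟩-+ p (- q) F ⟨
    ⟨ p + - q , F ⟩             ≡⟨ ⟨⟩-coeff-zero _ (p + - q) ℕ.≤-refl p-q≡0 F ⟩
    0ℤ                          ∎)
    where
    p-q≡0 : ∀ e → coeff (p + - q) e ≡ 0ℤ
    p-q≡0 e = begin
      coeff (p + - q) e                           ≡⟨ coeff≡⟨⟩ (p + - q) e ⟩
      ⟨ p + - q , [ e ≟_] ⟩                       ≡⟨ ⟨⟩-+ p (- q) _ ⟩
      ⟨ p , [ e ≟_] ⟩ ℤ.+ ⟨ - q , [ e ≟_] ⟩
        ≡⟨ cong₂ ℤ._+_ (sym (coeff≡⟨⟩ p e)) (trans (⟨⟩-neg q _) (cong ℤ.-_ (sym (coeff≡⟨⟩ q e)))) ⟩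
      coeff p e ℤ.- coeff q e                     ≡⟨ ℤ.i≡j⇒i-j≡0 (coeff-≡ p≈q e) ⟩
      0ℤ                                          ∎

ℤ[α]-commutativeRing : ℕ → CommutativeRing 0ℓ 0ℓ
ℤ[α]-commutativeRing m = record
  { Carrier = ℤ[α] m
  ; _≈_ = _≈_
  ; _+_ = _+_
  ; _*_ = _*_
  ; -_  = -_
  ; 0#  = []
  ; 1#  = const 1ℤ
  ; isCommutativeRing = record
    { isRing = record
      { +-isAbelianGroup = record
        { isGroup = record
          { isMonoid = record
            { isSemigroup = record
              { isMagma = record
                { isEquivalence = record
                  { refl  = mk≈ λ e → refl
                  ; sym   = λ p≈q → mk≈ λ e → sym (coeff-≡ p≈q e)
                  ; trans = λ p≈q q≈r → mk≈ λ e → trans (coeff-≡ p≈q e) (coeff-≡ q≈r e)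
                  }
                ; ∙-cong = λ {p} {q} {r} {s} p≈q r≈s → from-⟨⟩ λ F → trans (⟨⟩-+ p r F)
                    (trans (cong₂ ℤ._+_ (to-⟨⟩ p≈q F) (to-⟨⟩ r≈s F)) (sym (⟨⟩-+ q s F)))
                }
              ; assoc = λ p q r → from-⟨⟩ λ F → trans (⟨⟩-+ (p + q) r F)
                  (trans (cong (ℤ._+ ⟨ r , F ⟩) (⟨⟩-+ p q F))
                  (trans (ℤ.+-assoc ⟨ p , F ⟩ _ _)
                  (trans (cong (ℤ._+_ ⟨ p , F ⟩) (sym (⟨⟩-+ q r F))) (sym (⟨⟩-+ p (q + r) F)))))
              }
            ; identity = (λ p → mk≈ λ e → refl) ,
                (λ p → from-⟨⟩ λ F → trans (⟨⟩-+ p [] F) (ℤ.+-identityʳ _))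
            }
          ; inverse = (λ p → from-⟨⟩ λ F → trans (⟨⟩-+ (- p) p F)
                        (trans (cong (ℤ._+ ⟨ p , F ⟩) (⟨⟩-neg p F)) (ℤ.+-inverseˡ ⟨ p , F ⟩))) ,
                      (λ p → from-⟨⟩ λ F → trans (⟨⟩-+ p (- p) F)
                        (trans (cong (ℤ._+_ ⟨ p , F ⟩) (⟨⟩-neg p F)) (ℤ.+-inverseʳ ⟨ p , F ⟩)))
          ; ⁻¹-cong = λ {p} {q} p≈q → from-⟨⟩ λ F → trans (⟨⟩-neg p F)
              (trans (cong ℤ.-_ (to-⟨⟩ p≈q F)) (sym (⟨⟩-neg q F)))
          }
        ; comm = λ p q → from-⟨⟩ λ F → trans (⟨⟩-+ p q F)
            (trans (ℤ.+-comm ⟨ p , F ⟩ _) (sym (⟨⟩-+ q p F)))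
        }
      ; *-cong = λ {p} {q} {r} {s} p≈q r≈s → from-⟨⟩ λ F → trans (⟨⟩-* p r F)
          (trans (⟨⟩-cong p λ d → to-⟨⟩ r≈s _) (trans (to-⟨⟩ p≈q _) (sym (⟨⟩-* q s F))))
      ; *-assoc = λ p q r → from-⟨⟩ λ F → trans (⟨⟩-* (p * q) r F) (trans (⟨⟩-* p q _)
          (trans (⟨⟩-cong p λ d → trans
                   (⟨⟩-cong q λ e → ⟨⟩-cong r λ f → cong F (⊕-assoc d e f))
                   (sym (⟨⟩-* q r _)))
                 (sym (⟨⟩-* p (q * r) F))))
      ; *-identity = identityˡ , λ p → from-⟨⟩ λ F →
          trans (to-⟨⟩ (*-comm p (const 1ℤ)) F) (to-⟨⟩ (identityˡ p) F)
      ; distrib = (λ p q r → from-⟨⟩ λ F → trans (to-⟨⟩ (*-comm p (q + r)) F)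
                    (trans (distribʳ p q r F)
                    (trans (cong₂ ℤ._+_ (to-⟨⟩ (*-comm q p) F) (to-⟨⟩ (*-comm r p) F))
                           (sym (⟨⟩-+ (p * q) (p * r) F))))) ,
                  (λ p q r → from-⟨⟩ λ F → trans (distribʳ p q r F)
                    (sym (⟨⟩-+ (q * p) (r * p) F)))
      }
    ; *-comm = *-comm
    }
  }
  where
  open ≡ using (refl; sym; trans; cong; cong₂)
  open _≈_

  *-comm : ∀ (p q : ℤ[α] m) → p * q ≈ q * p
  *-comm p q = from-⟨⟩ λ F → trans (⟨⟩-* p q F) (trans (⟨⟩-swap p q _)
    (trans (⟨⟩-cong q λ e → ⟨⟩-cong p λ d → cong F (⊕-comm d e)) (sym (⟨⟩-* q p F))))

  identityˡ : ∀ (p : ℤ[α] m) → const 1ℤ * p ≈ p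
  identityˡ p = from-⟨⟩ λ F → trans (⟨⟩-* (const 1ℤ) p F)
    (trans (ℤ.+-identityʳ _) (trans (ℤ.*-identityˡ _) (⟨⟩-cong p λ d → cong F (⊕-identityˡ d))))

  distribʳ : ∀ (p q r : ℤ[α] m) F → ⟨ (q + r) * p , F ⟩ ≡ ⟨ q * p , F ⟩ ℤ.+ ⟨ r * p , F ⟩
  distribʳ p q r F = trans (⟨⟩-* (q + r) p F)
    (trans (⟨⟩-+ q r _) (cong₂ ℤ._+_ (sym (⟨⟩-* q p F)) (sym (⟨⟩-* r p F))))

-- Exponent vectors

module Exponents where
  open ≡ using (refl; sym; trans; cong; cong₂)

  unit : ∀ {m} → Fin m → Vec ℕ m
  unit {m} i = Vec.replicate m 0 [ i ]≔ 1

  replicate-[]≔ : ∀ {m} (i : Fin m) → Vec.replicate m 0 [ i ]≔ 0 ≡ Vec.replicate m 0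
  replicate-[]≔ zero    = refl
  replicate-[]≔ (suc i) = cong (0 ∷_) (replicate-[]≔ i)

  unit-[]≔ : ∀ {m} (i : Fin m) → unit i [ i ]≔ 0 ≡ Vec.replicate m 0
  unit-[]≔ i = trans (Vec.[]≔-idempotent _ i) (replicate-[]≔ i)

  unit-[]≔′ : ∀ {m} {i k : Fin m} → k ≢ i → unit k [ i ]≔ 0 ≡ unit k
  unit-[]≔′ {i = i} {k} k≢i = trans (Vec.[]≔-commutes _ k i k≢i) (cong (_[ k ]≔ 1) (replicate-[]≔ i))

  lookup-unit : ∀ {m} (i : Fin m) → lookup (unit i) i ≡ 1
  lookup-unit i = Vec.lookup∘update i (Vec.replicate _ 0) 1

  lookup-unit′ : ∀ {m} {i k : Fin m} → i ≢ k → lookup (unit k) i ≡ 0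
  lookup-unit′ {i = i} i≢k = trans (Vec.lookup∘update′ i≢k (Vec.replicate _ 0) 1) (Vec.lookup-replicate i 0)

  unit-⊕ : ∀ {m} (i : Fin m) d n → unit i ⊕ (d [ i ]≔ n) ≡ d [ i ]≔ suc n
  unit-⊕ zero    (_ ∷ d) n = cong (suc n ∷_) (⊕-identityˡ d)
  unit-⊕ (suc i) (k ∷ d) n = cong (k ∷_) (unit-⊕ i d n)

  ⊕-[]≔ : ∀ {m} (i : Fin m) d e → (d ⊕ e) [ i ]≔ 0 ≡ (d [ i ]≔ 0) ⊕ (e [ i ]≔ 0)
  ⊕-[]≔ zero    (_ ∷ d) (_ ∷ e) = refl
  ⊕-[]≔ (suc i) (j ∷ d) (k ∷ e) = cong (j ℕ.+ k ∷_) (⊕-[]≔ i d e)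

  ⊕-cancelˡ : ∀ {m} (d : Vec ℕ m) {e f} → d ⊕ e ≡ d ⊕ f → e ≡ f
  ⊕-cancelˡ []      {[]}    {[]}    _  = refl
  ⊕-cancelˡ (k ∷ d) {i ∷ e} {j ∷ f} eq =
    cong₂ _∷_ (ℕ.+-cancelˡ-≡ k i j (Vec.∷-injectiveˡ eq)) (⊕-cancelˡ d (Vec.∷-injectiveʳ eq))

open Exponents

-- Substitution for a variable, and the regular elements it detects

module _ {m : ℕ} where

  private
    module R = CommutativeRing (ℤ[α]-commutativeRing m)
  open Divisibility (ℤ[α]-commutativeRing m)
  open SemiringSolver R.commutativeSemiring using (solve; _:=_; _:+_; _:*_; con)
  open SemiringExp R.semiring using (^-homo-*)
  open AbelianGroupProperties R.+-abelianGroup using (x∙y⁻¹≈ε⇒x≈y)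
  open RingProperties R.ring using (-‿distribˡ-*)
  open _≈_
  open MagmaDefs R.*-rawMagma using (_,_)
  open import Relation.Binary.Reasoning.Setoid R.setoid

  monomial : Exponent → ℤ[α] m
  monomial d = (1ℤ , d) ∷ []

  ∷-expand : ∀ a d p → (a , d) ∷ p ≈ const a * monomial d + p
  ∷-expand a d p = R.reflexive (≡.cong₂ (λ b e → (b , e) ∷ p)
    (≡.sym (ℤ.*-identityʳ a)) (≡.sym (⊕-identityˡ d)))

  var-*-monomial : ∀ i d n → var i * monomial (d [ i ]≔ n) ≈ monomial (d [ i ]≔ suc n)
  var-*-monomial i d n = R.reflexive (≡.cong (λ e → (1ℤ , e) ∷ []) (unit-⊕ i d n))

  monomial-split : ∀ i d n → monomial (d [ i ]≔ n) ≈ var i ^ n * monomial (d [ i ]≔ 0)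
  monomial-split i d zero    = R.sym (R.*-identityˡ _)
  monomial-split i d (suc n) = begin
    monomial (d [ i ]≔ suc n)                   ≈⟨ var-*-monomial i d n ⟨
    var i * monomial (d [ i ]≔ n)               ≈⟨ R.*-congˡ {var i} (monomial-split i d n) ⟩
    var i * (var i ^ n * monomial (d [ i ]≔ 0)) ≈⟨ R.*-assoc (var i) (var i ^ n) _ ⟨
    var i ^ suc n * monomial (d [ i ]≔ 0)       ∎

  const-* : ∀ a (q : ℤ[α] m) F → ⟨ const a * q , F ⟩ ≡ a ℤ.* ⟨ q , F ⟩
  const-* a q F = ≡.trans (⟨⟩-* (const a) q F) (≡.trans (ℤ.+-identityʳ _)
    (≡.cong (a ℤ.*_) (⟨⟩-cong q λ e → ≡.cong F (⊕-identityˡ e))))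

  module Substitution (i : Fin m) (f : ℤ[α] m) where

    subst-monomial : Exponent → ℤ[α] m
    subst-monomial d = f ^ lookup d i * monomial (d [ i ]≔ 0)

    subst : ℤ[α] m → ℤ[α] m
    subst []            = []
    subst ((a , d) ∷ p) = const a * subst-monomial d + subst p

    ⟨subst⟩ : ∀ p F → ⟨ subst p , F ⟩ ≡ ⟨ p , (λ d → ⟨ subst-monomial d , F ⟩) ⟩
    ⟨subst⟩ []            F = ≡.refl
    ⟨subst⟩ ((a , d) ∷ p) F = ≡.trans (⟨⟩-+ (const a * subst-monomial d) (subst p) F)
      (≡.cong₂ ℤ._+_ (const-* a (subst-monomial d) F) (⟨subst⟩ p F))

    subst-cong : ∀ {p q} → p ≈ q → subst p ≈ subst q
    subst-cong {p} {q} p≈q = from-⟨⟩ λ F →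
      ≡.trans (⟨subst⟩ p F) (≡.trans (to-⟨⟩ p≈q _) (≡.sym (⟨subst⟩ q F)))

    subst-+ : ∀ p q → subst (p + q) ≈ subst p + subst q
    subst-+ p q = from-⟨⟩ λ F → ≡.trans (⟨subst⟩ (p + q) F) (≡.trans (⟨⟩-+ p q _)
      (≡.trans (≡.cong₂ ℤ._+_ (≡.sym (⟨subst⟩ p F)) (≡.sym (⟨subst⟩ q F)))
               (≡.sym (⟨⟩-+ (subst p) (subst q) F))))

    subst-neg : ∀ p → subst (- p) ≈ - subst p
    subst-neg p = from-⟨⟩ λ F → ≡.trans (⟨subst⟩ (- p) F) (≡.trans (⟨⟩-neg p _)
      (≡.trans (≡.cong ℤ.-_ (≡.sym (⟨subst⟩ p F))) (≡.sym (⟨⟩-neg (subst p) F))))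

    subst-monomial-⊕ : ∀ d e → subst-monomial (d ⊕ e) ≈ subst-monomial d * subst-monomial e
    subst-monomial-⊕ d e = begin
      f ^ lookup (d ⊕ e) i * monomial ((d ⊕ e) [ i ]≔ 0)
        ≈⟨ R.*-cong (R.reflexive (≡.cong (f ^_) (Vec.lookup-zipWith ℕ._+_ i d e)))
                    (R.reflexive (≡.cong monomial (⊕-[]≔ i d e))) ⟩
      f ^ (lookup d i ℕ.+ lookup e i) * (monomial (d [ i ]≔ 0) * monomial (e [ i ]≔ 0))
        ≈⟨ R.*-congʳ (^-homo-* f (lookup d i) (lookup e i)) ⟩
      (f ^ lookup d i * f ^ lookup e i) * (monomial (d [ i ]≔ 0) * monomial (e [ i ]≔ 0))
        ≈⟨ solve 4 (λ a b c d → a :* b :* (c :* d) := a :* c :* (b :* d)) R.refl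
             (f ^ lookup d i) (f ^ lookup e i) (monomial (d [ i ]≔ 0)) (monomial (e [ i ]≔ 0)) ⟩
      subst-monomial d * subst-monomial e ∎

    subst-* : ∀ p q → subst (p * q) ≈ subst p * subst q
    subst-* p q = from-⟨⟩ λ F → ≡.trans (⟨subst⟩ (p * q) F) (≡.trans (⟨⟩-* p q _)
      (≡.trans (⟨⟩-cong p λ d → ≡.trans
        (⟨⟩-cong q λ e → ≡.trans (to-⟨⟩ (subst-monomial-⊕ d e) F)
                                 (⟨⟩-* (subst-monomial d) (subst-monomial e) F))
        (≡.trans (⟨⟩-swap q (subst-monomial d) _)
                 (⟨⟩-cong (subst-monomial d) λ u → ≡.sym (⟨subst⟩ q _))))
      (≡.trans (≡.sym (⟨subst⟩ p _)) (≡.sym (⟨⟩-* (subst p) (subst q) F)))))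

    subst-const : ∀ a → subst (const a) ≈ const a
    subst-const a = begin
      const a * subst-monomial (Vec.replicate m 0) + []
        ≈⟨ R.+-identityʳ _ ⟩
      const a * subst-monomial (Vec.replicate m 0)
        ≈⟨ R.*-congˡ {const a} (R.*-cong (R.reflexive (≡.cong (f ^_) (Vec.lookup-replicate i 0)))
                               (R.reflexive (≡.cong monomial (replicate-[]≔ i)))) ⟩
      const a * (const 1ℤ * const 1ℤ)
        ≈⟨ R.trans (R.*-congˡ {const a} (R.*-identityˡ (const 1ℤ))) (R.*-identityʳ (const a)) ⟩
      const a ∎

    subst-var : subst (var i) ≈ f
    subst-var = begin
      const 1ℤ * (f ^ lookup (unit i) i * monomial (unit i [ i ]≔ 0)) + []
        ≈⟨ R.trans (R.+-identityʳ _) (R.*-identityˡ _) ⟩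
      f ^ lookup (unit i) i * monomial (unit i [ i ]≔ 0)
        ≈⟨ R.*-cong (R.reflexive (≡.cong (f ^_) (lookup-unit i)))
                    (R.reflexive (≡.cong monomial (unit-[]≔ i))) ⟩
      (f * const 1ℤ) * const 1ℤ
        ≈⟨ R.trans (R.*-identityʳ _) (R.*-identityʳ f) ⟩
      f ∎

    subst-var′ : ∀ {k} → k ≢ i → subst (var k) ≈ var k
    subst-var′ {k} k≢i = begin
      const 1ℤ * (f ^ lookup (unit k) i * monomial (unit k [ i ]≔ 0)) + []
        ≈⟨ R.trans (R.+-identityʳ _) (R.*-identityˡ _) ⟩
      f ^ lookup (unit k) i * monomial (unit k [ i ]≔ 0)
        ≈⟨ R.*-cong (R.reflexive (≡.cong (f ^_) (lookup-unit′ (k≢i ∘ ≡.sym))))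
                    (R.reflexive (≡.cong monomial (unit-[]≔′ k≢i))) ⟩
      const 1ℤ * var k
        ≈⟨ R.*-identityˡ (var k) ⟩
      var k ∎

    -- Modulo α_i - f the variable α_i is congruent to f, and congruence passes to powers, products
    -- and sums of terms.
    subst-≡ᵐ : ∀ p → _≡ᵐ_ (var i + - f) p (subst p)
    subst-≡ᵐ []            = ≡ᵐ-refl (var i + - f)
    subst-≡ᵐ ((a , d) ∷ p) = ≡ᵐ-resp π (R.sym (∷-expand a d p)) R.refl
      (≡ᵐ-+ π (≡ᵐ-* π (≡ᵐ-refl π {const a}) monomial≡) (subst-≡ᵐ p))
      where
      π : ℤ[α] m
      π = var i + - f

      var≡f : _≡ᵐ_ π (var i) f
      var≡f = const 1ℤ , R.sym (begin
        const 1ℤ * π + f         ≈⟨ R.+-congʳ (R.*-identityˡ π) ⟩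
        var i + - f + f          ≈⟨ R.+-assoc (var i) (- f) f ⟩
        var i + (- f + f)        ≈⟨ R.+-congˡ {var i} (R.-‿inverseˡ f) ⟩
        var i + []               ≈⟨ R.+-identityʳ (var i) ⟩
        var i                    ∎)

      monomial≡ : _≡ᵐ_ π (monomial d) (subst-monomial d)
      monomial≡ = ≡ᵐ-resp π
        (R.trans (R.sym (monomial-split i d (lookup d i)))
                 (R.reflexive (≡.cong monomial (Vec.[]≔-lookup d i))))
        R.refl (≡ᵐ-* π (≡ᵐ-^ π (lookup d i) var≡f) (≡ᵐ-refl π))

    -- π = α_i − f generates the kernel of the substitution α_i ↦ f.
    coprime-subst : ∀ q → subst f ≈ f → Regular (subst q) → Coprime q (var i + - f)
    coprime-subst q f-fixed reg .Coprime.cancel p (s , sπ≈qp) =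
      ≡ᵐ-0 (var i + - f) (subst-≡ᵐ p) (Regular.annihilate reg (subst p) (begin
        subst q * subst p                    ≈⟨ subst-* q p ⟨
        subst (q * p)                        ≈⟨ subst-cong sπ≈qp ⟨
        subst (s * (var i + - f))            ≈⟨ subst-* s (var i + - f) ⟩
        subst s * subst (var i + - f)        ≈⟨ R.*-congˡ {subst s} (subst-+ (var i) (- f)) ⟩
        subst s * (subst (var i) + subst (- f))
          ≈⟨ R.*-congˡ {subst s} (R.+-cong subst-var (R.trans (subst-neg f) (R.-‿cong f-fixed))) ⟩
        subst s * (f + - f)                  ≈⟨ R.*-congˡ {subst s} (R.-‿inverseʳ f) ⟩
        subst s * []                         ≈⟨ R.zeroʳ (subst s) ⟩
        []                                   ∎))

  coeff-var-* : ∀ i (p : ℤ[α] m) e → coeff (var i * p) (unit i ⊕ e) ≡ coeff p e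
  coeff-var-* i p e = ≡.trans (coeff≡⟨⟩ (var i * p) _) (≡.trans (⟨⟩-* (var i) p _)
    (≡.trans (ℤ.+-identityʳ _) (≡.trans (ℤ.*-identityˡ _)
    (≡.trans (⟨⟩-cong p shift) (≡.sym (coeff≡⟨⟩ p e))))))
    where
    shift : ∀ d → [ unit i ⊕ e ≟ unit i ⊕ d ] ≡ [ e ≟ d ]
    shift d with d ≟ᵉ e
    ... | yes ≡.refl rewrite dec-true (unit i ⊕ d ≟ᵉ unit i ⊕ d) ≡.refl = ≡.refl
    ... | no  d≢e    rewrite dec-false (unit i ⊕ d ≟ᵉ unit i ⊕ e) (d≢e ∘ ⊕-cancelˡ (unit i)) = ≡.refl

  coeff-var-*-zero : ∀ i (p : ℤ[α] m) e → lookup e i ≡ 0 → coeff (var i * p) e ≡ 0ℤ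
  coeff-var-*-zero i p e eᵢ≡0 = ≡.trans (coeff≡⟨⟩ (var i * p) _) (≡.trans (⟨⟩-* (var i) p _)
    (≡.trans (ℤ.+-identityʳ _) (≡.trans (ℤ.*-identityˡ _)
    (≡.trans (⟨⟩-cong p shift) (⟨⟩-zero p)))))
    where
    shift : ∀ d → [ e ≟ unit i ⊕ d ] ≡ 0ℤ
    shift d rewrite dec-false (unit i ⊕ d ≟ᵉ e) (λ eq → ℕ.1+n≢0
      (≡.trans (≡.sym (≡.trans (Vec.lookup-zipWith ℕ._+_ i (unit i) d) (≡.cong (ℕ._+ lookup d i) (lookup-unit i))))
        (≡.trans (≡.cong (λ v → lookup v i) eq) eᵢ≡0))) = ≡.refl

  regular-const : ∀ a → a ≢ 0ℤ → Regular (const a)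
  regular-const a a≢0 .Regular.annihilate p ap≈0 .coeff-≡ e
    with ℤ.i*j≡0⇒i≡0∨j≡0 a (≡.trans (≡.cong (a ℤ.*_) (coeff≡⟨⟩ p e))
           (≡.trans (≡.sym (const-* a p _)) (≡.trans (≡.sym (coeff≡⟨⟩ (const a * p) e)) (coeff-≡ ap≈0 e))))
  ... | inj₁ a≡0 = ⊥-elim (a≢0 a≡0)
  ... | inj₂ pₑ≡0 = pₑ≡0

  regular-var : ∀ i → Regular (var i)
  regular-var i .Regular.annihilate p αp≈0 .coeff-≡ e = ≡.trans (≡.sym (coeff-var-* i p e)) (coeff-≡ αp≈0 (unit i ⊕ e))

  -- Comparing coefficients, p_e = p_{e + u_i − u_j}, or p_e = 0 if e_j = 0.
  regular-difference : ∀ {i j} → i ≢ j → Regular (var i + - var j)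
  regular-difference {i} {j} i≢j .Regular.annihilate p πp≈0 .coeff-≡ e = vanish (lookup e j) e ≡.refl
    where
    αᵢp≈αⱼp : var i * p ≈ var j * p
    αᵢp≈αⱼp = x∙y⁻¹≈ε⇒x≈y (var i * p) (var j * p) (begin
      var i * p + - (var j * p)   ≈⟨ R.+-congˡ {var i * p} (-‿distribˡ-* (var j) p) ⟩
      var i * p + (- var j) * p   ≈⟨ R.distribʳ p (var i) (- var j) ⟨
      (var i + - var j) * p       ≈⟨ πp≈0 ⟩
      []                          ∎)

    lookup-shift : ∀ e → lookup (unit i ⊕ e) j ≡ lookup e j
    lookup-shift e = ≡.trans (Vec.lookup-zipWith ℕ._+_ j (unit i) e)
                             (≡.cong (ℕ._+ lookup e j) (lookup-unit′ (i≢j ∘ ≡.sym)))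

    swap : ∀ e → unit i ⊕ (unit j ⊕ e) ≡ unit j ⊕ (unit i ⊕ e)
    swap e = ≡.trans (≡.sym (⊕-assoc (unit i) (unit j) e))
               (≡.trans (≡.cong (_⊕ e) (⊕-comm (unit i) (unit j))) (⊕-assoc (unit j) (unit i) e))

    vanish : ∀ n e → lookup e j ≡ n → coeff p e ≡ 0ℤ
    vanish zero    e eⱼ≡0 = ≡.trans (≡.sym (coeff-var-* i p e)) (≡.trans (coeff-≡ αᵢp≈αⱼp _)
      (coeff-var-*-zero j p (unit i ⊕ e) (≡.trans (lookup-shift e) eⱼ≡0)))
    vanish (suc n) e eⱼ≡1+n = ≡.trans (≡.cong (coeff p) (≡.sym e≡))
      (≡.trans (≡.sym (coeff-var-* i p (unit j ⊕ e′))) (≡.trans (coeff-≡ αᵢp≈αⱼp _)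
      (≡.trans (≡.cong (coeff (var j * p)) (swap e′)) (≡.trans (coeff-var-* j p (unit i ⊕ e′))
      (vanish n (unit i ⊕ e′) (≡.trans (lookup-shift e′) (Vec.lookup∘update j e n)))))))
      where
      e′ : Exponent
      e′ = e [ j ]≔ n
      e≡ : unit j ⊕ e′ ≡ e
      e≡ = ≡.trans (unit-⊕ j e n) (≡.trans (≡.cong (e [ j ]≔_) (≡.sym eⱼ≡1+n)) (Vec.[]≔-lookup e j))

  -- The variables together with a point at 0, so that α_j and α_i − α_j
  -- both become differences of distinct points.
  point : Maybe (Fin m) → ℤ[α] m
  point nothing  = []
  point (just i) = var i

  infix 6 _⊖_
  _⊖_ : Maybe (Fin m) → Maybe (Fin m) → ℤ[α] m
  k ⊖ l = point k + - point l

  regular-⊖ : ∀ {k l} → k ≢ l → Regular (k ⊖ l)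
  regular-⊖ {nothing} {nothing} k≢l = ⊥-elim (k≢l ≡.refl)
  regular-⊖ {nothing} {just j}  k≢l = regular-neg {var j} (regular-var j)
  regular-⊖ {just i}  {nothing} k≢l = regular-resp (R.sym (R.+-identityʳ (var i))) (regular-var i)
  regular-⊖ {just i}  {just j}  k≢l = regular-difference (k≢l ∘ ≡.cong just)

  move : Fin m → Maybe (Fin m) → Maybe (Fin m) → Maybe (Fin m)
  move i l nothing  = nothing
  move i l (just k) = if does (k Fin.≟ i) then l else just k

  subst-point : ∀ i l k → Substitution.subst i (point l) (point k) ≈ point (move i l k)
  subst-point i l nothing = R.refl
  subst-point i l (just k) with k Fin.≟ i
  ... | yes ≡.refl = Substitution.subst-var i (point l)
  ... | no  k≢i    = Substitution.subst-var′ i (point l) k≢i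

  move-fixed : ∀ {i} l → l ≢ just i → move i l l ≡ l
  move-fixed nothing _ = ≡.refl
  move-fixed {i} (just k) k≢i rewrite dec-false (k Fin.≟ i) (k≢i ∘ ≡.cong just) = ≡.refl

  point-fixed : ∀ {i l} → l ≢ just i → Substitution.subst i (point l) (point l) ≈ point l
  point-fixed {i} {l} l≢i = R.trans (subst-point i l l) (R.reflexive (≡.cong point (move-fixed l l≢i)))

  -- The substitution carries points to points, so a difference of points goes to another such
  -- difference. It stays regular as long as the two labels are not merged.
  coprime-⊖ : ∀ {h k i l} → l ≢ just i → move i l h ≢ move i l k → Coprime (h ⊖ k) (just i ⊖ l)
  coprime-⊖ {h} {k} {i} {l} l≢i h≢k = coprime-subst (h ⊖ k) (point-fixed l≢i)
    (regular-resp (R.sym (begin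
      subst (h ⊖ k)                        ≈⟨ subst-+ (point h) (- point k) ⟩
      subst (point h) + subst (- point k)
        ≈⟨ R.+-cong (subst-point i l h) (R.trans (subst-neg (point k)) (R.-‿cong (subst-point i l k))) ⟩
      move i l h ⊖ move i l k              ∎)) (regular-⊖ h≢k))
    where open Substitution i (point l)

  coprime-const-⊖ : ∀ {a i l} → a ≢ 0ℤ → l ≢ just i → Coprime (const a) (just i ⊖ l)
  coprime-const-⊖ {a} {i} {l} a≢0 l≢i = coprime-subst (const a) (point-fixed l≢i)
    (regular-resp (R.sym (subst-const a)) (regular-const a a≢0))
    where open Substitution i (point l)

-- The minors of 𝒱

if-does : ∀ {a b p} {A : Set a} {B : Set b} (P : B → Set p) (d : Dec A) {x y : B} →
          (A → P x) → P y → P (if does d then x else y)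
if-does P (yes a) Px Py = Px a
if-does P (no  _) Px Py = Py

⊓-square : ∀ a b → (a ⊓ b) ℕ.* (a ⊓ b) ≡ (a ℕ.^ 2) ⊓ (b ℕ.^ 2)
⊓-square a b = ≡.trans (≡.cong ((a ⊓ b) ℕ.*_) (≡.sym (ℕ.*-identityʳ (a ⊓ b))))
                       (ℕ.mono-≤-distrib-⊓ (ℕ.^-monoˡ-≤ 2) a b)

rowOf : ∀ {m} (ν : Vector ℕ m) → Σ[ j ∈ Fin m ] Fin (ν j) → Fin (∑ ν)
rowOf {suc m} ν (zero  , i) = i ↑ˡ ∑ (tail ν)
rowOf {suc m} ν (suc j , i) = ν zero ↑ʳ rowOf (tail ν) (j , i)

rowIndex-rowOf : ∀ {m} (ν : Vector ℕ m) κ → rowIndex ν (rowOf ν κ) ≡ κ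
rowIndex-rowOf {suc m} ν (zero  , i) rewrite Fin.splitAt-↑ˡ (ν zero) i (∑ (tail ν)) = ≡.refl
rowIndex-rowOf {suc m} ν (suc j , i)
  rewrite Fin.splitAt-↑ʳ (ν zero) (∑ (tail ν)) (rowOf (tail ν) (j , i))
        | rowIndex-rowOf (tail ν) (j , i) = ≡.refl

rowOf-rowIndex : ∀ {m} (ν : Vector ℕ m) k → rowOf ν (rowIndex ν k) ≡ k
rowOf-rowIndex {suc m} ν k with splitAt (ν zero) k in eq
... | inj₁ i  = Fin.splitAt⁻¹-↑ˡ eq
... | inj₂ k′ = ≡.trans (≡.cong (ν zero ↑ʳ_) (rowOf-rowIndex (tail ν) k′)) (Fin.splitAt⁻¹-↑ʳ eq)

module _ {m : ℕ} (ν : Vector ℕ m) where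

  -- Forgetting the bound on the position gives keys of a simple product type, on which the row
  -- exchanges operate; the bound i < ν j returns as validity of a key.
  key : Fin (∑ ν) → Fin m × ℕ
  key k = let (j , i) = rowIndex ν k in j , toℕ i

  key-injective : Injective _≡_ _≡_ key
  key-injective {k} {k′} eq = ≡.trans (≡.sym (rowOf-rowIndex ν k))
    (≡.trans (≡.cong (rowOf ν) (toℕ-injective (rowIndex ν k) (rowIndex ν k′) eq)) (rowOf-rowIndex ν k′))
    where
    toℕ-injective : (κ λ′ : Σ[ j ∈ Fin m ] Fin (ν j)) →
                    (proj₁ κ , toℕ (proj₂ κ)) ≡ (proj₁ λ′ , toℕ (proj₂ λ′)) → κ ≡ λ′
    toℕ-injective (j , i) (j′ , i′) eq with ,-injectiveˡ eq
    ... | ≡.refl = ≡.cong (j ,_) (Fin.toℕ-injective (,-injectiveʳ eq))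

  key-surjective : ∀ {κ} → proj₂ κ < ν (proj₁ κ) → ∃[ k ] key k ≡ κ
  key-surjective {j , i} i<ν = rowOf ν (j , Fin.fromℕ< i<ν) ,
    ≡.trans (≡.cong (λ (j , i) → j , toℕ i) (rowIndex-rowOf ν _)) (≡.cong (j ,_) (Fin.toℕ-fromℕ< i<ν))

module _ {m : ℕ} where

  private module R = CommutativeRing (ℤ[α]-commutativeRing m)
  open Divisibility (ℤ[α]-commutativeRing m)
  open Differences (ℤ[α]-commutativeRing m) using (ι; ∂)

  ι≈const : ∀ n → ι n ≈ const (+ n)
  ι≈const zero    = from-⟨⟩ λ F → ≡.refl
  ι≈const (suc n) = R.trans (R.+-congˡ {const 1ℤ} (ι≈const n)) (from-⟨⟩ λ F →
    ≡.trans (≡.sym (ℤ.+-assoc (1ℤ ℤ.* F 0ᵉ) ((+ n) ℤ.* F 0ᵉ) 0ℤ))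
            (≡.cong (ℤ._+ 0ℤ) (≡.sym (ℤ.*-distribʳ-+ (F 0ᵉ) 1ℤ (+ n)))))
    where
    0ᵉ : Exponent
    0ᵉ = _

  ∂-zero : ∀ (x : ℤ[α] m) e → ∂ 0 x e ≡ x ^ e
  ∂-zero x zero    = ≡.refl
  ∂-zero x (suc e) = ≡.cong (x *_) (∂-zero x e)

  var≈⊖ : ∀ (i : Fin m) → just i ⊖ nothing ≈ var i
  var≈⊖ i = R.+-identityʳ (var i)

  move-other : ∀ {i k : Fin m} l → k ≢ i → move i l (just k) ≡ just k
  move-other {i} {k} l k≢i rewrite dec-false (k Fin.≟ i) k≢i = ≡.refl

  coprime-var-var : ∀ {i j : Fin m} → i ≢ j → Coprime (var i) (var j)
  coprime-var-var {i} {j} i≢j = coprime-resp (var≈⊖ i) (var≈⊖ j)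
    (coprime-⊖ (λ ()) λ eq → case-just (≡.trans (≡.sym (move-other nothing i≢j)) eq))
    where
    case-just : just i ≢ nothing
    case-just ()

  -- The substitution α_i ↦ α_j sends each variable to a variable, never to the point 0.
  coprime-var-difference : ∀ {h i j : Fin m} → i ≢ j → Coprime (var h) (var i + - var j)
  coprime-var-difference {h} {i} {j} i≢j =
    coprime-resp (var≈⊖ h) R.refl (coprime-⊖ (i≢j ∘ ≡.sym ∘ just-injective) moved)
    where
    moved : move i (just j) (just h) ≢ nothing
    moved with h Fin.≟ i
    ... | yes _ = λ ()
    ... | no  _ = λ ()

  -- The substitution α_i ↦ α_j merges only the labels i and j. As both pairs are ordered, distinct
  -- pairs are distinct sets, so h and k stay apart; for k = i this is h < i < j.
  coprime-difference-difference : ∀ {h k i j : Fin m} → h Fin.< k → i Fin.< j → (h , k) ≢ (i , j) →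
                                  Coprime (var h + - var k) (var i + - var j)
  coprime-difference-difference {h} {k} {i} {j} h<k i<j hk≢ij =
    coprime-⊖ (Fin.<⇒≢ i<j ∘ ≡.sym ∘ just-injective) moved
    where
    moved : move i (just j) (just h) ≢ move i (just j) (just k)
    moved with h Fin.≟ i
    ... | yes ≡.refl rewrite move-other {h} {k} (just j) (Fin.<⇒≢ h<k ∘ ≡.sym) =
      λ eq → hk≢ij (≡.cong (h ,_) (≡.sym (just-injective eq)))
    ... | no  h≢i with k Fin.≟ i
    ...   | yes ≡.refl = Fin.<⇒≢ (Fin.<-trans h<k i<j) ∘ just-injective
    ...   | no  k≢i    = Fin.<⇒≢ h<k ∘ just-injective

-- The divisor as a product of coprime powers

module Factors {m : ℕ} (ν : Vector ℕ m) where

  private module R = CommutativeRing (ℤ[α]-commutativeRing m)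
  open Divisibility (ℤ[α]-commutativeRing m)

  exponent : Fin m → Fin m → ℕ
  exponent i j = (ν i ℕ.^ 2) ⊓ (ν j ℕ.^ 2)

  power : Fin m → ℤ[α] m
  power j = var j ^ (ν j C 2)

  difference : Fin m → Fin m → ℤ[α] m
  difference i j = if does (i Fin.<? j) then (var i + - var j) ^ exponent i j else const 1ℤ

  regular-power : ∀ j → Regular (power j)
  regular-power j = regular-^ (ν j C 2) (regular-var j)

  regular-diff : ∀ i j → Regular (difference i j)
  regular-diff i j = if-does Regular (i Fin.<? j)
    (λ i<j → regular-^ (exponent i j) (regular-difference (Fin.<⇒≢ i<j))) regular-1

  coprime-diff : ∀ {q} i j → (i Fin.< j → Coprime q (var i + - var j)) → Coprime q (difference i j)
  coprime-diff {q} i j coprime = if-does (Coprime q) (i Fin.<? j)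
    (λ i<j → coprime-^ʳ (exponent i j) (regular-difference (Fin.<⇒≢ i<j)) (coprime i<j)) coprime-1ʳ

  coprime-diff-diff : ∀ {h k i j} → (h , k) ≢ (i , j) → Coprime (difference h k) (difference i j)
  coprime-diff-diff {h} {k} {i} {j} hk≢ij = coprime-diff i j λ i<j →
    if-does (λ q → Coprime q (var i + - var j)) (h Fin.<? k)
      (λ h<k → coprime-^ˡ (exponent h k) (coprime-difference-difference h<k i<j hk≢ij)) coprime-1ˡ

  coprime-divisor : ∀ {q} → (∀ j → Coprime q (var j)) →
                    (∀ {i j} → i Fin.< j → Coprime q (var i + - var j)) → Coprime q (divisor ν)
  coprime-divisor cop-var cop-diff = coprime-*ʳ (regular-product regular-power)
    (coprime-productʳ regular-power λ j → coprime-^ʳ (ν j C 2) (regular-var j) (cop-var j))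
    (coprime-productʳ (λ i → regular-product (regular-diff i)) λ i →
     coprime-productʳ (regular-diff i) λ j → coprime-diff i j cop-diff)

  coprime-const-divisor : ∀ {a} → a ≢ 0ℤ → Coprime (const a) (divisor ν)
  coprime-const-divisor a≢0 = coprime-divisor
    (λ j → coprime-resp R.refl (var≈⊖ j) (coprime-const-⊖ a≢0 λ ()))
    (λ i<j → coprime-const-⊖ a≢0 (Fin.<⇒≢ i<j ∘ ≡.sym ∘ just-injective))

  -- The double product is joined row by row: factors in different rows differ in the first index,
  -- factors in one row in the second. A trivial factor for i ≥ j divides everything.
  divisor-∣ : ∀ {p} → (∀ j → power j ∣ p) →
              (∀ {i j} → i Fin.< j → (var i + - var j) ^ exponent i j ∣ p) → divisor ν ∣ p
  divisor-∣ {p} power∣p diff∣p = *-∣ {product power} {product λ i → product (difference i)}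
    (coprime-productˡ λ h → coprime-productʳ regular-row λ i → coprime-productʳ (regular-diff i) λ j →
     coprime-diff i j λ i<j → coprime-^ˡ (ν h C 2) (coprime-var-difference (Fin.<⇒≢ i<j)))
    (product-∣ regular-power
      (λ {i} {j} i≢j → coprime-^ʳ (ν j C 2) (regular-var j) (coprime-^ˡ (ν i C 2) (coprime-var-var i≢j)))
      power∣p)
    (product-∣ regular-row
      (λ {h} {i} h≢i → coprime-productʳ (regular-diff i) λ j → coprime-productˡ {q = difference h} λ k →
         coprime-diff-diff (h≢i ∘ ,-injectiveˡ))
      λ i → product-∣ (regular-diff i) (λ j≢k → coprime-diff-diff (j≢k ∘ ,-injectiveʳ))
      λ j → if-does (_∣ p) (i Fin.<? j) diff∣p (p , R.*-identityʳ p))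
    where
    open MagmaDefs R.*-rawMagma using (_,_)
    regular-row : ∀ i → Regular (product (difference i))
    regular-row i = regular-product (regular-diff i)

-- Divisibility of a single minor

module AlternatingForms {m : ℕ} (ν : Vector ℕ m) (ν≥1 : ∀ j → 1 ≤ ν j) (L : ℕ)
    (φ : (Fin m × ℕ → Vector (ℤ[α] m) (suc L)) → ℤ[α] m)
    (alternating : Exchange.Alternating (ℤ[α]-commutativeRing m) (λ (j , i) → i < ν j) φ) where

  private module R = CommutativeRing (ℤ[α]-commutativeRing m)
  open Divisibility (ℤ[α]-commutativeRing m)
  open Exchange (ℤ[α]-commutativeRing m)
  open MagmaDefs R.*-rawMagma using (_,_)
  -- Rows keep all L + 1 columns here; the selection of columns for the minor is made inside `φ`.
  open Blocks (ℤ[α]-commutativeRing m) L toℕ (λ h → ℕ.s≤s⁻¹ (Fin.toℕ<n h)) (λ (j , i) → i < ν j)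
    alternating

  matrix : Fin m × ℕ → Vector (ℤ[α] m) (suc L)
  matrix (j , i) h = const (+ ((L ℕ.+ suc i) C toℕ h)) * var j ^ (L ∸ toℕ h)

  matrix≋row : ∀ j i h → matrix (j , i) h ≈ row (var j) 0 i h
  matrix≋row j i h = R.*-cong (R.sym (ι≈const ((L ℕ.+ suc i) C toℕ h)))
    (R.reflexive (≡.sym (∂-zero (var j) (L ∸ toℕ h))))

  ⟿⇒∣ : ∀ {p d q} → (∀ {a} → a ≢ 0ℤ → Coprime (const a) d) → p ⟿[ d ] q → d ∣ p
  ⟿⇒∣ {p} {d} {q} coprime (factor a s eq) =
    Coprime.cancel (coprime {+ suc a} (λ ())) p (s * q , R.trans (R.*-comm (s * q) d)
      (R.trans (R.sym eq) (R.*-congʳ {p} (ι≈const (suc a)))))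

  suc-pred : ∀ {n} → 1 ≤ n → suc (pred n) ≡ n
  suc-pred (s≤s _) = ≡.refl

  power-∣ : ∀ j → var j ^ (ν j C 2) ∣ φ matrix
  power-∣ j = ≡.subst (λ n → var j ^ (n C 2) ∣ φ matrix) 1+n≡ν
    (⟿⇒∣ {d = var j ^ (suc n C 2)} coprime (proj₂ φ⟿))
    where
    n : ℕ
    n = pred (ν j)
    1+n≡ν : suc n ≡ ν j
    1+n≡ν = suc-pred (ν≥1 j)
    coprime : ∀ {a} → a ≢ 0ℤ → Coprime (const a) (var j ^ (suc n C 2))
    coprime a≢0 = coprime-^ʳ (suc n C 2) (regular-var j)
      (coprime-resp R.refl (var≈⊖ j) (coprime-const-⊖ a≢0 λ ()))
    φ⟿ : ∃[ q ] φ matrix ⟿[ var j ^ (suc n C 2) ] q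
    φ⟿ = variable-power (var j) j n (λ i i≤n → ℕ.≤-trans (s≤s i≤n) (ℕ.≤-reflexive 1+n≡ν))
           matrix (λ i _ → matrix≋row j i)

  difference-∣ : ∀ {i j} → i Fin.< j →
                 (var i + - var j) ^ ((ν i ℕ.^ 2) ⊓ (ν j ℕ.^ 2)) ∣ φ matrix
  difference-∣ {i} {j} i<j = ≡.subst (λ k → (var i + - var j) ^ k ∣ φ matrix)
    (≡.trans (≡.cong (λ k → k ℕ.* k) 1+n≡ν⊓ν) (⊓-square (ν i) (ν j)))
    (⟿⇒∣ {d = (var i + - var j) ^ (suc n ℕ.* suc n)} coprime (proj₂ φ⟿))
    where
    i≢j : i ≢ j
    i≢j = Fin.<⇒≢ i<j
    n : ℕ
    -- The last position, counted from 0, among the rows that take part in both blocks.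
    n = pred (ν i ⊓ ν j)
    1+n≡ν⊓ν : suc n ≡ ν i ⊓ ν j
    1+n≡ν⊓ν = suc-pred (ℕ.⊓-glb (ν≥1 i) (ν≥1 j))
    coprime : ∀ {a} → a ≢ 0ℤ → Coprime (const a) ((var i + - var j) ^ (suc n ℕ.* suc n))
    coprime a≢0 = coprime-^ʳ (suc n ℕ.* suc n) (regular-difference i≢j)
      (coprime-const-⊖ a≢0 (i≢j ∘ ≡.sym ∘ just-injective))
    φ⟿ : ∃[ q ] φ matrix ⟿[ (var i + - var j) ^ (suc n ℕ.* suc n) ] q
    φ⟿ = difference-power (var i) (var j) i≢j n
      (λ k k≤n → ℕ.≤-trans (s≤s k≤n) (ℕ.≤-trans (ℕ.≤-reflexive 1+n≡ν⊓ν) (ℕ.m⊓n≤m (ν i) (ν j))))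
      (λ k k≤n → ℕ.≤-trans (s≤s k≤n) (ℕ.≤-trans (ℕ.≤-reflexive 1+n≡ν⊓ν) (ℕ.m⊓n≤n (ν i) (ν j))))
      matrix (λ k _ → matrix≋row i k) (λ k _ → matrix≋row j k)

  divisor-∣ : divisor ν ∣ φ matrix
  divisor-∣ = Factors.divisor-∣ ν power-∣ difference-∣

divisor-∣-minor : ∀ {m} (ν l : Vector ℕ m) → (∀ j → 1 ≤ ν j) → ∀ columns →
                  divisor ν ∣ maximalMinor (𝒱 ν l) columns
divisor-∣-minor {m} ν l ν≥1 (c , _) = AlternatingForms.divisor-∣ ν ν≥1 (∑ l)
  (λ A → det λ i j → A (key ν i) (c j))
  (Exchange.minor-alternating (ℤ[α]-commutativeRing m) (key ν) (key-injective ν) (key-surjective ν) c)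

theorem6p2 : (m : ℕ) → 1 ≤ m →
    (ν l : Vector ℕ m) →
    (∀ (j : Fin m) → 1 ≤ ν j × ν j ≤ l j) →
    (D : ℤ[α] m) → IsPrimitiveGCD (maximalMinor (𝒱 ν l)) D →
    divisor ν ∣ D
theorem6p2 m _ ν l bounds D D-gcd = Coprime.cancel
  (Factors.coprime-const-divisor ν {content} (ℕ.≢-nonZero⁻¹ ℤ.∣ content ∣ {{content-nonZero}} ∘ ≡.cong ℤ.∣_∣)) D
  -- A common divisor of the minors divides `gcd`, hence the product of `content` and `D`.
  (∣ʳ-respʳ-≈ gcd≈content*D
    (IsGCD.greatest gcd-isGCD (divisor ν) (divisor-∣-minor ν l (proj₁ ∘ bounds))))
  where
  open IsPrimitiveGCD D-gcd
  open Divisibility (ℤ[α]-commutativeRing m) using (module Coprime)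
  open MagmaDivisibility (CommutativeRing.*-magma (ℤ[α]-commutativeRing m)) using (∣ʳ-respʳ-≈)
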